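{- For an arbitrary $n$-round online ordinal task with reward function $R:\mathcal{A}\times \mathrm{Sym}(n)\times \mathrm{Sym}(n)\to \mathbb{R}_{+}$, an arbitrary distribution $\mathcal{D}_\pi$ of arrival orders $\pi\in\mathrm{Sym}(n)$, an arbitrary distribution $\mathcal{D}_\sigma$ of rankings $\sigma\in\mathrm{Sym}(n)$, and any $\varepsilon>0$, there exist a sufficiently large integer $N\in\mathbb{N}$ and a distribution $\mathcal{F}$ of $n$-element sets $S\subseteq[N]$ such that $$\max_{\mathrm{ALG}\in\mathtt{Card}}\ \mathbf{E}_{\pi\sim\mathcal{D}_\pi,\ \mathbf{v}=(S,\sigma)\sim\mathcal{F}\times\mathcal{D}_\sigma}\big[R(\mathrm{ALG}(\mathbf{v},\pi),\sigma,\pi)\big]\ \le\ (1+\varepsilon)\cdot\max_{\mathrm{ALG}\in\mathtt{Ord}}\ \mathbf{E}_{\pi\sim\mathcal{D}_\pi,\ \sigma\sim\mathcal{D}_\sigma}\big[R(\mathrm{ALG}(\sigma,\pi),\sigma,\pi)\big].$$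
   Context: Notation: $[m]=\{1,\dots,m\}$; $\mathrm{Sym}(n)$ is the set of permutations of $[n]$. Online ordinal task. There are $n$ elements $e_1,\dots,e_n$ arriving one by one in the order $\pi=(\pi(1),\dots,\pi(n))\in\mathrm{Sym}(n)$, drawn from a known distribution $\mathcal{D}_\pi$; $\pi[k]=(\pi(1),\dots,\pi(k))$. The elements carry $n$ distinct integers $\mathbf{v}=(v_1,\dots,v_n)\in[N]^n$. The vector $\mathbf{v}$ is identified with the pair $(S,\sigma)$, where $S=\{v_1,\dots,v_n\}\subseteq[N]$ is the unordered set of values and $\sigma\in\mathrm{Sym}(n)$ is the ranking: $v_i$ is the $\sigma(i)$-th largest number of $S$. At step $k$ the element $e_{\pi(k)}$ and its number $v_{\pi(k)}$ are revealed and the algorithm chooses an action $a_k$ from an action set $A_k$. The output is $\mathbf{a}=(a_1,\dots,a_n)$; the feasible outputs form a set $\mathcal{A}\subseteq A_1\times\dots\times A_n$. The reward is $R(\mathbf{a},\sigma,\pi)\ge 0$, with $R(\mathbf{a},\sigma,\pi)=0$ if $\mathbf{a}\notin\mathcal{A}$; it does not depend on $S$ given $\mathbf{a},\sigma,\pi$. $\mathtt{Card}$ is the family of all online algorithms: $a_k$ is a function of $\pi[k]$ and $\mathbf{v}_{\pi[k]}=(v_{\pi(1)},\dots,v_{\pi(k)})$; the output is written $\mathrm{ALG}(\mathbf{v},\pi)$. $\mathtt{Ord}$ is the family of ordinal algorithms: $a_k$ is a function of $\pi[k]$ and the relative ranking $\sigma(\mathbf{v}_{\pi[k]})$ of the $k$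 arrived numbers only; the output is written $\mathrm{ALG}(\sigma,\pi)$. Algorithms may be randomized (mixtures of deterministic ones). The algorithms know the distributions. $\pi$, $S$ and $\sigma$ are drawn independently. A maximum that is not attained is read as a supremum. -}

module Defs where

open import Data.Fin.Base using (Fin; zero; suc; toℕ; inject≤; cast; opposite)
open import Data.Fin.Permutation as Perm using (Permutation′; _⟨$⟩ʳ_)
open import Data.Fin.Properties using (toℕ<n; _<?_)
open import Data.Fin.Subset using (Subset; inside; outside; ∣_∣)
open import Data.Nat.Base as ℕ using (ℕ)
import Data.Nat.Properties as ℕ
open import Data.Product.Base using (Σ; ∃; _×_; _,_; proj₁; proj₂)
open import Data.Rational.Base as ℚ using (ℚ; 0ℚ; 1ℚ; ½)
import Data.Rational.Properties as ℚ
open import Data.Rational.Solver using (module +-*-Solver)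
open import Data.Vec.Base as Vec using (Vec; []; _∷_)
import Data.Vec.Functional as Vector
open import Level using (Level; _⊔_) renaming (suc to lsuc)
open import Relation.Binary.PropositionalEquality
  using (_≡_; refl; sym; trans; cong; subst)
open import Relation.Nullary using (¬_)
open import Relation.Unary using (Pred; _⊆_)

private
  variable
    ℓ ℓ′ : Level
    n N : ℕ

------------------------------------------------------------------------
-- Real numbers: Cauchy sequences of rationals, with the equality _≃_ of
-- sequences whose difference tends to zero

record ℝ : Set where
  constructor mkℝ
  field
    seq    : ℕ → ℚ
    cauchy : ∀ e → 0ℚ ℚ.< e →
             ∃ λ M → ∀ i j → M ℕ.≤ i → M ℕ.≤ j → ℚ.∣ seq i ℚ.- seq j ∣ ℚ.< e

open ℝ public

infix 4 _≃_ _≤_ _<_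

record _≃_ (x y : ℝ) : Set where
  constructor mk≃
  field
    close : ∀ e → 0ℚ ℚ.< e →
            ∃ λ M → ∀ i → M ℕ.≤ i → ℚ.∣ seq x i ℚ.- seq y i ∣ ℚ.< e

record _≤_ (x y : ℝ) : Set where
  constructor mk≤
  field
    below : ∀ e → 0ℚ ℚ.< e → ∃ λ M → ∀ i → M ℕ.≤ i → seq x i ℚ.≤ seq y i ℚ.+ e

record _<_ (x y : ℝ) : Set where
  constructor mk<
  field
    gap   : ℚ
    gap>0 : 0ℚ ℚ.< gap
    apart : ∃ λ M → ∀ i → M ℕ.≤ i → seq x i ℚ.+ gap ℚ.≤ seq y i

private
  Bound : ℝ → Set
  Bound x = ∃ λ K → ℚ.Positive K × ∃ λ M → ∀ i → M ℕ.≤ i → ℚ.∣ seq x i ∣ ℚ.< K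

  half : ∀ e → 0ℚ ℚ.< e → 0ℚ ℚ.< e ℚ.* ½
  half e 0<e = ℚ.*-monoˡ-<-pos ½ 0<e

  halves : ∀ e → e ℚ.* ½ ℚ.+ e ℚ.* ½ ≡ e
  halves e = trans (sym (ℚ.*-distribˡ-+ e ½ ½)) (ℚ.*-identityʳ e)

  half< : ∀ {p} → 0ℚ ℚ.< p → p ℚ.< p ℚ.+ p
  half< {p} 0<p = subst (ℚ._< p ℚ.+ p) (ℚ.+-identityʳ p) (ℚ.+-monoʳ-< p 0<p)

  sum-diff : ∀ a b c d → (a ℚ.+ b) ℚ.- (c ℚ.+ d) ≡ (a ℚ.- c) ℚ.+ (b ℚ.- d)
  sum-diff = solve 4 (λ a b c d → (a :+ b) :- (c :+ d) := (a :- c) :+ (b :- d)) refl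
    where open +-*-Solver

  product-diff : ∀ a b c d →
    (a ℚ.* b) ℚ.- (c ℚ.* d) ≡ a ℚ.* (b ℚ.- d) ℚ.+ d ℚ.* (a ℚ.- c)
  product-diff = solve 4 (λ a b c d →
    (a :* b) :- (c :* d) := a :* (b :- d) :+ d :* (a :- c)) refl
    where open +-*-Solver

  split : ∀ a b → a ≡ b ℚ.+ (a ℚ.- b)
  split = solve 2 (λ a b → a := b :+ (a :- b)) refl
    where open +-*-Solver

  0<1ℚ : 0ℚ ℚ.< 1ℚ
  0<1ℚ = ℚ.positive⁻¹ 1ℚ

  bound : ∀ x → Bound x
  bound x with M , close ← cauchy x 1ℚ 0<1ℚ =
    ℚ.∣ a ∣ ℚ.+ 1ℚ , ℚ.positive (ℚ.+-mono-≤-< (ℚ.0≤∣p∣ a) 0<1ℚ) , M , λ i M≤i → begin-strict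
      ℚ.∣ seq x i ∣                        ≡⟨ cong ℚ.∣_∣ (split (seq x i) a) ⟩
      ℚ.∣ a ℚ.+ (seq x i ℚ.- a) ∣          ≤⟨ ℚ.∣p+q∣≤∣p∣+∣q∣ a (seq x i ℚ.- a) ⟩
      ℚ.∣ a ∣ ℚ.+ ℚ.∣ seq x i ℚ.- a ∣      <⟨ ℚ.+-monoʳ-< ℚ.∣ a ∣ (close i M M≤i ℕ.≤-refl) ⟩
      ℚ.∣ a ∣ ℚ.+ 1ℚ                       ∎
    where
    open ℚ.≤-Reasoning
    a = seq x M

  -- For every K > 0 and e > 0 there is d > 0 with K d = e.
  quotient : ∀ K → ℚ.Positive K → ∀ e → 0ℚ ℚ.< e → ∃ λ d → 0ℚ ℚ.< d × K ℚ.* d ≡ e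
  quotient K K>0 e 0<e = r ℚ.* e ,
    ℚ.positive⁻¹ (r ℚ.* e) {{ℚ.pos*pos⇒pos r e}} ,
    trans (sym (ℚ.*-assoc K r e))
      (trans (cong (ℚ._* e) (ℚ.*-inverseʳ K)) (ℚ.*-identityˡ e))
    where
    instance
      K-pos = K>0
      K-nonZero = ℚ.pos⇒nonZero K
      e-pos = ℚ.positive 0<e
    r = ℚ.1/ K
    instance
      r-pos = ℚ.1/pos⇒pos K

  small-product : ∀ K → ℚ.Positive K → ∀ {a b d} →
    ℚ.∣ a ∣ ℚ.< K → ℚ.∣ b ∣ ℚ.< d → ℚ.∣ a ℚ.* b ∣ ℚ.≤ K ℚ.* d
  small-product K K>0 {a} {b} {d} a<K b<d = begin
    ℚ.∣ a ℚ.* b ∣         ≡⟨ ℚ.∣p*q∣≡∣p∣*∣q∣ a b ⟩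
    ℚ.∣ a ∣ ℚ.* ℚ.∣ b ∣   ≤⟨ ℚ.*-monoʳ-≤-nonNeg ℚ.∣ b ∣ {{ℚ.∣-∣-nonNeg b}} (ℚ.<⇒≤ a<K) ⟩
    K ℚ.* ℚ.∣ b ∣         ≤⟨ ℚ.*-monoˡ-≤-nonNeg K {{ℚ.pos⇒nonNeg K {{K>0}}}} (ℚ.<⇒≤ b<d) ⟩
    K ℚ.* d               ∎
    where open ℚ.≤-Reasoning

  sum-close : ∀ {a b c d} e → ℚ.∣ a ℚ.- c ∣ ℚ.< e ℚ.* ½ → ℚ.∣ b ℚ.- d ∣ ℚ.< e ℚ.* ½ →
    ℚ.∣ (a ℚ.+ b) ℚ.- (c ℚ.+ d) ∣ ℚ.< e
  sum-close {a} {b} {c} {d} e a~c b~d = begin-strict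
    ℚ.∣ (a ℚ.+ b) ℚ.- (c ℚ.+ d) ∣           ≡⟨ cong ℚ.∣_∣ (sum-diff a b c d) ⟩
    ℚ.∣ (a ℚ.- c) ℚ.+ (b ℚ.- d) ∣           ≤⟨ ℚ.∣p+q∣≤∣p∣+∣q∣ (a ℚ.- c) (b ℚ.- d) ⟩
    ℚ.∣ a ℚ.- c ∣ ℚ.+ ℚ.∣ b ℚ.- d ∣         <⟨ ℚ.+-mono-< a~c b~d ⟩
    e ℚ.* ½ ℚ.+ e ℚ.* ½                     ≡⟨ halves e ⟩
    e                                       ∎
    where open ℚ.≤-Reasoning

  product-close : ∀ K → ℚ.Positive K → ∀ L → ℚ.Positive L → ∀ {a b c d p q} e → 0ℚ ℚ.< e →
    K ℚ.* p ≡ e ℚ.* ½ ℚ.* ½ → L ℚ.* q ≡ e ℚ.* ½ ℚ.* ½ →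
    ℚ.∣ a ∣ ℚ.< K → ℚ.∣ d ∣ ℚ.< L → ℚ.∣ b ℚ.- d ∣ ℚ.< p → ℚ.∣ a ℚ.- c ∣ ℚ.< q →
    ℚ.∣ a ℚ.* b ℚ.- c ℚ.* d ∣ ℚ.< e
  product-close K K>0 L L>0 {a} {b} {c} {d} {p} {q} e 0<e Kp Lq a<K d<L b~d a~c = begin-strict
    ℚ.∣ a ℚ.* b ℚ.- c ℚ.* d ∣
      ≡⟨ cong ℚ.∣_∣ (product-diff a b c d) ⟩
    ℚ.∣ a ℚ.* (b ℚ.- d) ℚ.+ d ℚ.* (a ℚ.- c) ∣
      ≤⟨ ℚ.∣p+q∣≤∣p∣+∣q∣ (a ℚ.* (b ℚ.- d)) (d ℚ.* (a ℚ.- c)) ⟩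
    ℚ.∣ a ℚ.* (b ℚ.- d) ∣ ℚ.+ ℚ.∣ d ℚ.* (a ℚ.- c) ∣
      ≤⟨ ℚ.+-mono-≤ (small-product K K>0 {a} {b ℚ.- d} a<K b~d)
                    (small-product L L>0 {d} {a ℚ.- c} d<L a~c) ⟩
    K ℚ.* p ℚ.+ L ℚ.* q
      ≡⟨ trans (cong (ℚ._+ L ℚ.* q) Kp) (cong (e ℚ.* ½ ℚ.* ½ ℚ.+_) Lq) ⟩
    e ℚ.* ½ ℚ.* ½ ℚ.+ e ℚ.* ½ ℚ.* ½
      ≡⟨ halves (e ℚ.* ½) ⟩
    e ℚ.* ½
      <⟨ subst (e ℚ.* ½ ℚ.<_) (halves e) (half< (half e 0<e)) ⟩
    e ∎
    where open ℚ.≤-Reasoning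

  product-cauchy : ∀ x y → Bound x → Bound y → ∀ e → 0ℚ ℚ.< e → ∃ λ M → ∀ i j →
    M ℕ.≤ i → M ℕ.≤ j → ℚ.∣ seq x i ℚ.* seq y i ℚ.- seq x j ℚ.* seq y j ∣ ℚ.< e
  product-cauchy x y (K , K>0 , Mx , x<K) (L , L>0 , My , y<L) e 0<e =
    combine (quotient K K>0 (e ℚ.* ½ ℚ.* ½) 0<e/4) (quotient L L>0 (e ℚ.* ½ ℚ.* ½) 0<e/4)
    where
    0<e/4 : 0ℚ ℚ.< e ℚ.* ½ ℚ.* ½
    0<e/4 = half (e ℚ.* ½) (half e 0<e)

    combine : (∃ λ p → 0ℚ ℚ.< p × K ℚ.* p ≡ e ℚ.* ½ ℚ.* ½) →
      (∃ λ q → 0ℚ ℚ.< q × L ℚ.* q ≡ e ℚ.* ½ ℚ.* ½) → ∃ λ M → ∀ i j →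
      M ℕ.≤ i → M ℕ.≤ j → ℚ.∣ seq x i ℚ.* seq y i ℚ.- seq x j ℚ.* seq y j ∣ ℚ.< e
    combine (p , 0<p , Kp) (q , 0<q , Lq) =
      (Mx ℕ.⊔ My) ℕ.⊔ (proj₁ y~ ℕ.⊔ proj₁ x~) , λ i j M≤i M≤j →
        product-close K K>0 L L>0 {seq x i} {seq y i} {seq x j} {seq y j} {p} {q} e 0<e Kp Lq
          (x<K i (ℕ.m⊔n≤o⇒m≤o Mx My (ℕ.m⊔n≤o⇒m≤o _ _ M≤i)))
          (y<L j (ℕ.m⊔n≤o⇒n≤o Mx My (ℕ.m⊔n≤o⇒m≤o _ _ M≤j)))
          (proj₂ y~ i j (left M≤i) (left M≤j))
          (proj₂ x~ i j (right M≤i) (right M≤j))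
      where
      y~ = cauchy y p 0<p
      x~ = cauchy x q 0<q

      left : ∀ {i} → (Mx ℕ.⊔ My) ℕ.⊔ (proj₁ y~ ℕ.⊔ proj₁ x~) ℕ.≤ i → proj₁ y~ ℕ.≤ i
      left M≤i = ℕ.m⊔n≤o⇒m≤o _ _ (ℕ.m⊔n≤o⇒n≤o (Mx ℕ.⊔ My) _ M≤i)

      right : ∀ {i} → (Mx ℕ.⊔ My) ℕ.⊔ (proj₁ y~ ℕ.⊔ proj₁ x~) ℕ.≤ i → proj₁ x~ ℕ.≤ i
      right M≤i = ℕ.m⊔n≤o⇒n≤o (proj₁ y~) _ (ℕ.m⊔n≤o⇒n≤o (Mx ℕ.⊔ My) _ M≤i)

  -- Opaque: these proofs are irrelevant to every notion below, and unfolding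
  -- them is expensive.
  abstract
    constant-cauchy : ∀ q e → 0ℚ ℚ.< e → ∃ λ M → ∀ i j →
      M ℕ.≤ i → M ℕ.≤ j → ℚ.∣ q ℚ.- q ∣ ℚ.< e
    constant-cauchy q e 0<e =
      0 , λ _ _ _ _ → subst (ℚ._< e) (cong ℚ.∣_∣ (sym (ℚ.+-inverseʳ q))) 0<e

    +-cauchy : ∀ x y e → 0ℚ ℚ.< e → ∃ λ M → ∀ i j → M ℕ.≤ i → M ℕ.≤ j →
      ℚ.∣ (seq x i ℚ.+ seq y i) ℚ.- (seq x j ℚ.+ seq y j) ∣ ℚ.< e
    +-cauchy x y e 0<e =
      let M₁ , x~ = cauchy x (e ℚ.* ½) (half e 0<e)
          M₂ , y~ = cauchy y (e ℚ.* ½) (half e 0<e)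
      in M₁ ℕ.⊔ M₂ , λ i j M≤i M≤j →
        sum-close {seq x i} {seq y i} {seq x j} {seq y j} e
          (x~ i j (ℕ.m⊔n≤o⇒m≤o M₁ M₂ M≤i) (ℕ.m⊔n≤o⇒m≤o M₁ M₂ M≤j))
          (y~ i j (ℕ.m⊔n≤o⇒n≤o M₁ M₂ M≤i) (ℕ.m⊔n≤o⇒n≤o M₁ M₂ M≤j))

    *-cauchy : ∀ x y e → 0ℚ ℚ.< e → ∃ λ M → ∀ i j → M ℕ.≤ i → M ℕ.≤ j →
      ℚ.∣ seq x i ℚ.* seq y i ℚ.- seq x j ℚ.* seq y j ∣ ℚ.< e
    *-cauchy x y = product-cauchy x y (bound x) (bound y)

fromℚ : ℚ → ℝ
fromℚ q = mkℝ (λ _ → q) (constant-cauchy q)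

0ℝ 1ℝ : ℝ
0ℝ = fromℚ 0ℚ
1ℝ = fromℚ 1ℚ

infixl 6 _+_
infixl 7 _*_

_+_ : ℝ → ℝ → ℝ
x + y = mkℝ (λ i → seq x i ℚ.+ seq y i) (+-cauchy x y)

_*_ : ℝ → ℝ → ℝ
x * y = mkℝ (λ i → seq x i ℚ.* seq y i) (*-cauchy x y)

∑ : (Fin n → ℝ) → ℝ
∑ = Vector.foldr _+_ 0ℝ

------------------------------------------------------------------------
-- Suprema in the extended reals.  As the reals are not order complete
-- constructively, and a supremum may be infinite, an extended real is
-- represented by the set of the reals strictly below it.

ExtendedReal : (ℓ : Level) → Set (lsuc ℓ)
ExtendedReal ℓ = Pred ℝ ℓ

sup : {I : Set ℓ} → (I → ℝ) → ExtendedReal ℓ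
sup f q = ∃ λ i → q < f i

infix 4 _≤̂_
_≤̂_ : ExtendedReal ℓ → ExtendedReal ℓ′ → Set (ℓ ⊔ ℓ′)
u ≤̂ v = u ⊆ v

-- Multiplication by a positive real.
infixl 7 _·̂_
_·̂_ : ℝ → ExtendedReal ℓ → ExtendedReal ℓ
(c ·̂ u) q = ∃ λ r → u r × q < c * r

------------------------------------------------------------------------
-- Probability distributions are finitely supported weighted families.  An
-- outcome may repeat, so no equality on A is needed; on a finite set these are
-- all the distributions, and on a set of algorithms the finite mixtures.

record Distribution (A : Set ℓ) : Set ℓ where
  field
    size     : ℕ
    outcome  : Fin size → A
    weight   : Fin size → ℝ
    weight≥0 : ∀ i → 0ℝ ≤ weight i
    total    : ∑ weight ≃ 1ℝ

𝔼[_] : {A : Set ℓ} → Distribution A → (A → ℝ) → ℝ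
𝔼[ D ] f = ∑ λ i → weight i * f (outcome i)
  where open Distribution D

------------------------------------------------------------------------
-- Values and rankings.  Elements, ranks and values are counted from 0;
-- rank 0 is the largest value.

Sym : ℕ → Set
Sym = Permutation′

NSubset : ℕ → ℕ → Set
NSubset n N = Σ (Subset N) λ S → ∣ S ∣ ≡ n

nthSmallest : (S : Subset N) → Fin ∣ S ∣ → Fin N
nthSmallest (outside ∷ S) i       = suc (nthSmallest S i)
nthSmallest (inside  ∷ S) zero    = zero
nthSmallest (inside  ∷ S) (suc i) = suc (nthSmallest S i)

nthLargest : NSubset n N → Fin n → Fin N
nthLargest (S , ∣S∣≡n) i = nthSmallest S (opposite (cast (sym ∣S∣≡n) i))

values : NSubset n N → Sym n → Fin n → Fin N
values S σ i = nthLargest S (σ ⟨$⟩ʳ i)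

-- The elements arriving in the rounds up to and including k (from 0), in order.
arrived : Sym n → (k : Fin n) → Vec (Fin n) (ℕ.suc (toℕ k))
arrived π k = Vec.tabulate λ j → π ⟨$⟩ʳ inject≤ j (toℕ<n k)

-- The rank of each entry among the entries of the vector.  The entries are
-- overall ranks, so those ahead of an entry (larger values) are the smaller ones.
relativeRanking : ∀ {m} → Vec (Fin n) m → Vec ℕ m
relativeRanking ranks = Vec.map (λ r → Vec.count (_<? r) ranks) ranks

record OnlineTask (ℓ : Level) (n : ℕ) : Set (lsuc ℓ) where
  field
    Action     : Fin n → Set ℓ
    Feasible   : (∀ k → Action k) → Set ℓ
    R          : (∀ k → Action k) → Sym n → Sym n → ℝ
    R≥0        : ∀ a σ π → 0ℝ ≤ R a σ π
    infeasible : ∀ a σ π → ¬ Feasible a → R a σ π ≃ 0ℝ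
    -- Outputs and permutations are functions, identified when they agree pointwise.
    R-cong     : ∀ {a a′ σ σ′ π π′} → (∀ k → a k ≡ a′ k) →
                 σ Perm.≈ σ′ → π Perm.≈ π′ → R a σ π ≃ R a′ σ′ π′

module _ (T : OnlineTask ℓ n) where
  open OnlineTask T

  -- A deterministic algorithm picks the action of round k from the elements
  -- arrived so far and their values or, if ordinal, their relative ranking.
  DetCard : ℕ → Set ℓ
  DetCard N = (k : Fin n) → Vec (Fin n) (ℕ.suc (toℕ k)) → Vec (Fin N) (ℕ.suc (toℕ k)) → Action k

  DetOrd : Set ℓ
  DetOrd = (k : Fin n) → Vec (Fin n) (ℕ.suc (toℕ k)) → Vec ℕ (ℕ.suc (toℕ k)) → Action k

  runCard : DetCard N → (Fin n → Fin N) → Sym n → ∀ k → Action k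
  runCard alg v π k = alg k (arrived π k) (Vec.map v (arrived π k))

  runOrd : DetOrd → Sym n → Sym n → ∀ k → Action k
  runOrd alg σ π k =
    alg k (arrived π k) (relativeRanking (Vec.map (σ ⟨$⟩ʳ_) (arrived π k)))

  Card : ℕ → Set ℓ
  Card N = Distribution (DetCard N)

  Ord : Set ℓ
  Ord = Distribution DetOrd

  cardReward : Distribution (Sym n) → Distribution (NSubset n N) → Distribution (Sym n) →
               Card N → ℝ
  cardReward Dπ F Dσ ALG =
    𝔼[ Dπ ] λ π → 𝔼[ F ] λ S → 𝔼[ Dσ ] λ σ → 𝔼[ ALG ] λ alg →
      R (runCard alg (values S σ) π) σ π

  ordReward : Distribution (Sym n) → Distribution (Sym n) → Ord → ℝ
  ordReward Dπ Dσ ALG =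
    𝔼[ Dπ ] λ π → 𝔼[ Dσ ] λ σ → 𝔼[ ALG ] λ alg →
      R (runOrd alg σ π) σ π

{-# OPTIONS --safe #-}

-- It suffices to construct a law of n-element sets and a random online
-- simulator that turns relative ranks into values, such that, for every order
-- in which the ranks arrive, the law of the true values is at most (1 + ε)
-- times the law of the simulated ones: a cardinal algorithm is then run on
-- simulated values, and rewards are non-negative.
--
-- Both are built by recursion on n.  Among n + 1 ranks the best one has a value
-- x, and any other rank r the value x - w r / B ^ s r, where s is the decreasing
-- sequence of values of the n remaining ranks, drawn recursively, and w r is
-- uniform on an interval [B ^ e, B ^ (e + 1)).  These drops grow so fast in r
-- that the distance from a rank c to a better rank r has nearly the same law,
-- given s, for all r.  So the simulator compares each new rank with the best
-- one so far, passes the worse rank c of the two to the simulator one level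
-- below, which returns s c, and puts the values w′ / B ^ s c apart, with w′
-- uniform on [0, B ^ (e + 1)).  Both laws are uniform in the seeds (x, w, ...).
-- Shifting w c by drop r * B ^ s c embeds the seeds of sets into the seeds of
-- simulators, and the numbers of seeds have a ratio (B / (B - 1)) ^ m, with m
-- independent of B.

module Submission where

open import Algebra.Bundles using (CommutativeSemiring)
import Algebra.Properties.Semiring.Sum as Sum
open import Data.Fin.Base as Fin
  using (Fin; zero; suc; toℕ; fromℕ<; inject≤; cast; opposite; punchIn; punchOut; combine; remQuot; _↑ˡ_; _↑ʳ_)
open import Data.Fin.Permutation using (Permutation′; _⟨$⟩ʳ_; _⟨$⟩ˡ_; _∘ₚ_; inverseˡ; inverseʳ)
import Data.Fin.Properties as Fin
open import Data.Fin.Properties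
  using (toℕ<n; toℕ-fromℕ<; toℕ-injective; 1↔⊤; *↔×; punchOut-injective; punchIn-punchOut;
         suc-injective; 0≢1+n; remQuot-combine)
open import Data.Fin.Subset using (Subset; inside; outside; ∣_∣)
open import Data.Integer.Base as ℤ using (+_; +[1+_])
import Data.Integer.Properties as ℤ
open import Data.Nat.Base as ℕ using (ℕ; zero; suc; pred; NonZero; z≤n; s≤s; z<s; s<s; s<s⁻¹)
import Data.Nat.Coprimality as ℕ
open import Data.Nat.DivMod
  using (_/_; _%_; _mod_; m<n⇒m%n≡m; m*n/n≡m; m<n*o⇒m/o<n; m/n≤m; m/n*n≤m; /-monoˡ-≤; [m∸n*o]/o≡m/o∸n)
import Data.Nat.Properties as ℕ
open import Data.Product.Base using (Σ; ∃; _×_; _,_; proj₁; proj₂; uncurry)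
open import Data.Product.Function.NonDependent.Propositional using (_×-↔_)
open import Data.Product.Properties using (,-injectiveˡ; ,-injectiveʳ)
open import Data.Nat.Solver renaming (module +-*-Solver to ℕ-Solver) using ()
open import Data.Rational.Base as ℚ using (ℚ; mkℚ; 0ℚ; 1ℚ; ½)
import Data.Rational.Properties as ℚ
open import Data.Rational.Solver using (module +-*-Solver)
import Data.Rational.Unnormalised.Base as ℚᵘ
import Data.Rational.Unnormalised.Properties as ℚᵘ
open import Data.Sum.Base using (_⊎_; inj₁; inj₂)
open import Data.Unit.Base using (⊤; tt)
open import Data.Vec.Base as Vec using (Vec; []; _∷_)
import Data.Vec.Properties as Vec
open import Function.Base using (_∘_)
open import Function.Bundles using (_↔_; mk↔ₛ′; Inverse)
open import Function.Definitions using (Injective)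
open import Function.Properties.Inverse using (↔-refl; ↔-sym; ↔-trans)
open import Level using (Level; 0ℓ)
open import Relation.Binary.Definitions using (tri<; tri≈; tri>)
open import Relation.Binary.PropositionalEquality
  using (_≡_; _≢_; refl; sym; trans; cong; cong₂; subst; subst₂; module ≡-Reasoning)
open import Relation.Nullary using (yes; no; ¬_; contradiction)
open import Relation.Unary using (Pred; Decidable; _⊆_)

private
  variable
    ℓ ℓ′ : Level
    A : Set ℓ
    C : Set ℓ′
    m n N : ℕ

module Combinatorics where
  open import Data.Nat.Base
  open import Data.Nat.Properties

  private
    variable
      k l : ℕ
      τ τ′ : ℕ → ℕ

  -- Best and displaced ranks in a sequence of arrivals

  best : (ℕ → ℕ) → ℕ → ℕ
  best τ zero    = τ 0
  best τ (suc k) = best τ k ⊓ τ (suc k)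

  -- The rank that leaves the lead, or fails to take it, in round `k + 1`. Each round after the
  -- first displaces one rank, so this sequence is shorter by one.
  displaced : (ℕ → ℕ) → ℕ → ℕ
  displaced τ k = best τ k ⊔ τ (suc k)

  -- Rank 0 is never displaced, so lowering by one gives the ranking passed to the level below.
  next : (ℕ → ℕ) → ℕ → ℕ
  next τ = pred ∘ displaced τ

  OrderIso : ℕ → (ℕ → ℕ) → (ℕ → ℕ) → Set
  OrderIso l τ τ′ = ∀ {i j} → i < l → j < l → (τ i < τ j → τ′ i < τ′ j) × (τ′ i < τ′ j → τ i < τ j)

  -- A common index attains both minima, so that comparisons with `best` are comparisons of entries
  -- and can be carried along the isomorphism.
  best-index : OrderIso l τ τ′ → k < l → ∃ λ i → i ≤ k × best τ k ≡ τ i × best τ′ k ≡ τ′ i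
  best-index {k = zero} _ _ = 0 , z≤n , refl , refl
  best-index {τ = τ} {τ′} {suc k} iso k<l with best-index {k = k} iso (<⇒≤ k<l)
  ... | i , i≤k , eq , eq′ rewrite eq | eq′ with τ i <? τ (suc k)
  ...   | yes lt = i , m≤n⇒m≤1+n i≤k , m≤n⇒m⊓n≡m (<⇒≤ lt) ,
                   m≤n⇒m⊓n≡m (<⇒≤ (proj₁ (iso (≤-<-trans i≤k (<⇒≤ k<l)) k<l) lt))
  ...   | no ¬lt = suc k , ≤-refl , m≥n⇒m⊓n≡n (≮⇒≥ ¬lt) ,
                   m≥n⇒m⊓n≡n (≮⇒≥ (¬lt ∘ proj₂ (iso (≤-<-trans i≤k (<⇒≤ k<l)) k<l)))

  displaced-index : OrderIso l τ τ′ → suc k < l →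
    ∃ λ i → i ≤ suc k × displaced τ k ≡ τ i × displaced τ′ k ≡ τ′ i
  displaced-index {τ = τ} {τ′} {k} iso k<l with best-index {k = k} iso (<⇒≤ k<l)
  ... | i , i≤k , eq , eq′ rewrite eq | eq′ with τ i <? τ (suc k)
  ...   | yes lt = suc k , ≤-refl , m≤n⇒m⊔n≡n (<⇒≤ lt) ,
                   m≤n⇒m⊔n≡n (<⇒≤ (proj₁ (iso (≤-<-trans i≤k (<⇒≤ k<l)) k<l) lt))
  ...   | no ¬lt = i , m≤n⇒m≤1+n i≤k , m≥n⇒m⊔n≡m (≮⇒≥ ¬lt) ,
                   m≥n⇒m⊔n≡m (≮⇒≥ (¬lt ∘ proj₂ (iso (≤-<-trans i≤k (<⇒≤ k<l)) k<l)))

  -- Displaced ranks are entries at common indices. The one numbered `k` depends on the first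
  -- `k + 2` entries, hence the shorter prefix.
  displaced-iso : OrderIso (suc l) τ τ′ → OrderIso l (displaced τ) (displaced τ′)
  displaced-iso iso i<l j<l
    with displaced-index iso (s≤s i<l) | displaced-index iso (s≤s j<l)
  ... | i , i≤ , eqᵢ , eqᵢ′ | j , j≤ , eqⱼ , eqⱼ′ rewrite eqᵢ | eqᵢ′ | eqⱼ | eqⱼ′ =
    iso (≤-<-trans i≤ (s≤s i<l)) (≤-<-trans j≤ (s≤s j<l))

  iso-refl : OrderIso l τ τ
  iso-refl _ _ = (λ p → p) , (λ p → p)

  iso-respʳ : ∀ {τ″} → OrderIso l τ τ′ → (∀ {i} → i < l → τ′ i ≡ τ″ i) → OrderIso l τ τ″
  iso-respʳ iso eq i<l j<l = subst₂ _<_ (eq i<l) (eq j<l) ∘ proj₁ (iso i<l j<l) ,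
    proj₂ (iso i<l j<l) ∘ subst₂ _<_ (sym (eq i<l)) (sym (eq j<l))

  -- Rankings and the displaced ranking one level below

  record IsRanking (n : ℕ) (τ : ℕ → ℕ) : Set where
    field
      bounded    : ∀ {k} → k < n → τ k < n
      injective  : ∀ {i j} → i < n → j < n → τ i ≡ τ j → i ≡ j
      surjective : ∀ {r} → r < n → ∃ λ k → k < n × τ k ≡ r

  module _ (ranking : IsRanking n τ) where
    open IsRanking ranking

    best≢ : suc k < n → best τ k ≢ τ (suc k)
    best≢ k<n eq with best-index iso-refl (<⇒≤ k<n)
    ... | i , i≤k , eqᵢ , _ = <⇒≢ (s≤s i≤k)
      (injective (≤-<-trans i≤k (<⇒≤ k<n)) k<n (trans (sym eqᵢ) eq))

    best<displaced : suc k < n → best τ (suc k) < displaced τ k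
    best<displaced k<n = ≤∧≢⇒< (m⊓n≤m⊔n _ _) λ eq → best≢ k<n (⊓≡⊔⇒≡ _ _ eq)
      where
      ⊓≡⊔⇒≡ : ∀ a b → a ⊓ b ≡ a ⊔ b → a ≡ b
      ⊓≡⊔⇒≡ a b eq = ≤-antisym (≤-trans (m≤m⊔n a b) (≤-trans (≤-reflexive (sym eq)) (m⊓n≤n a b)))
        (≤-trans (m≤n⊔m a b) (≤-trans (≤-reflexive (sym eq)) (m⊓n≤m a b)))

    suc-next : suc k < n → displaced τ k ≡ suc (next τ k)
    suc-next {k} k<n =
      sym (suc-pred (displaced τ k) {{>-nonZero (≤-<-trans z≤n (best<displaced k<n))}})

    displaced-bounded : suc k < n → displaced τ k < n
    displaced-bounded k<n with displaced-index iso-refl k<n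
    ... | i , i≤ , eq , _ = subst (_< n) (sym eq) (bounded (≤-<-trans i≤ k<n))

    best-bounded : k < n → best τ k < n
    best-bounded k<n with best-index iso-refl k<n
    ... | i , i≤ , eq , _ = subst (_< n) (sym eq) (bounded (≤-<-trans i≤ k<n))

    best-antitone : ∀ i k → i ≤ k → best τ k ≤ best τ i
    best-antitone i k i≤k with m≤n⇒m<n∨m≡n i≤k
    ... | inj₂ refl = ≤-refl
    best-antitone i (suc k) _ | inj₁ (s≤s i≤k) = ≤-trans (m⊓n≤m _ _) (best-antitone i k i≤k)

    -- The later displaced rank is either the new arrival, not seen before, or the best so far,
    -- which is strictly better than anything displaced earlier.
    displaced-distinct : ∀ {i j} → i < j → suc j < n → displaced τ i ≢ displaced τ j
    displaced-distinct {i} {j} i<j j<n eq with ⊔-sel (best τ j) (τ (suc j))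
    ... | inj₁ sel = <⇒≢ (≤-<-trans (best-antitone (suc i) j i<j) (best<displaced (≤-<-trans i<j (<⇒≤ j<n))))
                       (sym (trans eq sel))
    ... | inj₂ sel with displaced-index {k = i} iso-refl (≤-<-trans i<j (<⇒≤ j<n))
    ...   | i′ , i′≤ , eq′ , _ = <⇒≢ (s≤s (≤-trans i′≤ i<j))
            (injective (≤-<-trans (≤-trans i′≤ i<j) (<⇒≤ j<n)) j<n (trans (sym eq′) (trans eq sel)))

    -- Every rank seen so far is either the best one or has been displaced.
    best-or-displaced : ∀ {k} j → j ≤ k → τ j ≡ best τ k ⊎ ∃ λ i → i < k × displaced τ i ≡ τ j
    best-or-displaced {zero} zero _ = inj₁ refl
    best-or-displaced {suc k} j j≤ with ≤-total (best τ k) (τ (suc k)) | m≤n⇒m<n∨m≡n j≤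
    ... | inj₁ le | inj₂ refl = inj₂ (k , ≤-refl , m≤n⇒m⊔n≡n le)
    ... | inj₂ ge | inj₂ refl = inj₁ (sym (m≥n⇒m⊓n≡n ge))
    ... | le⊎ge | inj₁ (s≤s j≤k) with best-or-displaced {k} j j≤k
    ...   | inj₂ (i , i<k , eq) = inj₂ (i , m≤n⇒m≤1+n i<k , eq)
    ...   | inj₁ eq with le⊎ge
    ...     | inj₁ le = inj₁ (trans eq (sym (m≤n⇒m⊓n≡m le)))
    ...     | inj₂ ge = inj₂ (k , ≤-refl , trans (m≥n⇒m⊔n≡m ge) (sym eq))

  -- After the last round rank 0 is the only one never displaced, so the displaced ranks are 1, ...,
  -- n, each once.
  next-ranking : IsRanking (suc n) τ → IsRanking n (next τ)
  next-ranking {n} {τ} ranking = record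
    { bounded    = λ k<n → s≤s⁻¹ (subst (_< suc n) (suc-next ranking (s≤s k<n)) (displaced-bounded ranking (s≤s k<n)))
    ; injective  = next-injective
    ; surjective = next-surjective }
    where
    open IsRanking ranking
    displaced-≡ : ∀ {i j} → i < n → j < n → next τ i ≡ next τ j → displaced τ i ≡ displaced τ j
    displaced-≡ i<n j<n eq =
      trans (suc-next ranking (s≤s i<n)) (trans (cong suc eq) (sym (suc-next ranking (s≤s j<n))))
    next-injective : ∀ {i j} → i < n → j < n → next τ i ≡ next τ j → i ≡ j
    next-injective {i} {j} i<n j<n eq with <-cmp i j
    ... | tri< i<j _ _ = contradiction (displaced-≡ i<n j<n eq) (displaced-distinct ranking i<j (s≤s j<n))
    ... | tri≈ _ i≡j _ = i≡j
    ... | tri> _ _ j<i = contradiction (sym (displaced-≡ i<n j<n eq)) (displaced-distinct ranking j<i (s≤s i<n))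
    best≡0 : best τ n ≡ 0
    best≡0 with surjective {0} z<s
    ... | k , k<n , eq with best-or-displaced ranking {n} k (s≤s⁻¹ k<n)
    ...   | inj₁ eq′ = trans (sym eq′) eq
    ...   | inj₂ (i , i<n , eq′) with () ← trans (sym (suc-next ranking (s≤s i<n))) (trans eq′ eq)
    next-surjective : ∀ {r} → r < n → ∃ λ k → k < n × next τ k ≡ r
    next-surjective {r} r<n with surjective {suc r} (s≤s r<n)
    ... | k , k<n , eq with best-or-displaced ranking {n} k (s≤s⁻¹ k<n)
    ...   | inj₁ eq′ with () ← trans (sym best≡0) (trans (sym eq′) eq)
    ...   | inj₂ (i , i<n , eq′) = i , i<n , cong pred (trans eq′ eq)

  -- The simulator sees only relative order and recurses on `displaced`; this allows the analysis to
  -- recurse on the ranking `next` instead.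
  displaced-next-iso : IsRanking (suc n) τ → OrderIso n (displaced τ) (next τ)
  displaced-next-iso ranking i<n j<n
    rewrite suc-next ranking (s≤s i<n) | suc-next ranking (s≤s j<n) = s≤s⁻¹ , s≤s

  -- Values recovered from distances to the best element

  -- Here d k is the distance between the values of the element of round k + 1
  -- and the best one before it; topValue follows the value of the best one.
  topValue : ℕ → (ℕ → ℕ) → (ℕ → ℕ) → ℕ → ℕ
  topValue x d τ zero = x
  topValue x d τ (suc k) with best τ k <? τ (suc k)
  ... | yes _ = topValue x d τ k
  ... | no  _ = topValue x d τ k + d k

  value : ℕ → (ℕ → ℕ) → (ℕ → ℕ) → ℕ → ℕ
  value x d τ zero = x
  value x d τ (suc k) with best τ k <? τ (suc k)
  ... | yes _ = topValue x d τ k ∸ d k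
  ... | no  _ = topValue x d τ k + d k

  module _ {x x′ : ℕ} {d d′ : ℕ → ℕ} (x≡x′ : x ≡ x′) (iso : OrderIso l τ τ′) where

    best-iso : suc k < l →
      (best τ k < τ (suc k) → best τ′ k < τ′ (suc k)) × (best τ′ k < τ′ (suc k) → best τ k < τ (suc k))
    best-iso k<l with best-index iso (<⇒≤ k<l)
    ... | i , i≤k , eq , eq′ rewrite eq | eq′ = iso (≤-<-trans i≤k (<⇒≤ k<l)) k<l

    -- The recursion branches only on comparisons with the best rank, which the isomorphism
    -- preserves.
    topValue-cong : ∀ k → k < l → (∀ j → suc j < l → d j ≡ d′ j) → topValue x d τ k ≡ topValue x′ d′ τ′ k
    topValue-cong zero    _   _    = x≡x′
    topValue-cong (suc k) k<l d≡d′ with best τ k <? τ (suc k) | best τ′ k <? τ′ (suc k)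
    ... | yes _  | yes _  = topValue-cong k (<⇒≤ k<l) d≡d′
    ... | no _   | no _   = cong₂ _+_ (topValue-cong k (<⇒≤ k<l) d≡d′) (d≡d′ k k<l)
    ... | yes lt | no ¬lt = contradiction (proj₁ (best-iso k<l) lt) ¬lt
    ... | no ¬lt | yes lt = contradiction (proj₂ (best-iso k<l) lt) ¬lt

    value-cong : ∀ k → k < l → (∀ j → suc j < l → d j ≡ d′ j) → value x d τ k ≡ value x′ d′ τ′ k
    value-cong zero    _   _    = x≡x′
    value-cong (suc k) k<l d≡d′ with best τ k <? τ (suc k) | best τ′ k <? τ′ (suc k)
    ... | yes _  | yes _  = cong₂ _∸_ (topValue-cong k (<⇒≤ k<l) d≡d′) (d≡d′ k k<l)
    ... | no _   | no _   = cong₂ _+_ (topValue-cong k (<⇒≤ k<l) d≡d′) (d≡d′ k k<l)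
    ... | yes lt | no ¬lt = contradiction (proj₁ (best-iso k<l) lt) ¬lt
    ... | no ¬lt | yes lt = contradiction (proj₂ (best-iso k<l) lt) ¬lt

  module _ (ranking : IsRanking n τ) (X : ℕ) (ν : ℕ → ℕ)
    (ν-mono : ∀ {r s} → r < s → s < n → ν r < ν s) (ν≤X : ∀ {r} → r < n → ν r ≤ X)
    where

    private
      d : ℕ → ℕ
      d k = ν (displaced τ k) ∸ ν (best τ (suc k))
      v : ℕ → ℕ
      v r = X ∸ ν r

      down : ∀ {r s} → r < s → s < n → v r ∸ (ν s ∸ ν r) ≡ v s
      down {r} {s} r<s s<n = trans (∸-+-assoc X (ν r) (ν s ∸ ν r)) (cong (X ∸_) (m+[n∸m]≡n (<⇒≤ (ν-mono r<s s<n))))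

      up : ∀ {r s} → r < s → s < n → v s + (ν s ∸ ν r) ≡ v r
      up {r} {s} r<s s<n = begin-equality
        X ∸ ν s + (ν s ∸ ν r)    ≡⟨ +-∸-assoc (X ∸ ν s) (<⇒≤ (ν-mono r<s s<n)) ⟨
        X ∸ ν s + ν s ∸ ν r      ≡⟨ cong (_∸ ν r) (m∸n+n≡m (ν≤X s<n)) ⟩
        X ∸ ν r                  ∎
        where open ≤-Reasoning

      step : suc k < n → τ (suc k) < best τ k → v (best τ k) + d k ≡ v (τ (suc k))
      step {k} k<n lt rewrite m≥n⇒m⊓n≡n (<⇒≤ lt) | m≥n⇒m⊔n≡m (<⇒≤ lt) =
        up lt (best-bounded ranking (<⇒≤ k<n))

      step′ : suc k < n → best τ k < τ (suc k) → v (best τ k) ∸ d k ≡ v (τ (suc k))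
      step′ {k} k<n lt rewrite m≤n⇒m⊓n≡m (<⇒≤ lt) | m≤n⇒m⊔n≡n (<⇒≤ lt) =
        down lt (IsRanking.bounded ranking k<n)

      reverse : suc k < n → ¬ best τ k < τ (suc k) → τ (suc k) < best τ k
      reverse k<n ¬lt = ≤∧≢⇒< (≮⇒≥ ¬lt) (best≢ ranking k<n ∘ sym)

    topValue-correct : ∀ k → k < n → topValue (v (τ 0)) d τ k ≡ v (best τ k)
    topValue-correct zero    _   = refl
    topValue-correct (suc k) k<n with best τ k <? τ (suc k)
    ... | yes lt = trans (topValue-correct k (<⇒≤ k<n)) (cong v (sym (m≤n⇒m⊓n≡m (<⇒≤ lt))))
    ... | no ¬lt = trans (cong (_+ d k) (topValue-correct k (<⇒≤ k<n)))
      (trans (step k<n (reverse k<n ¬lt)) (cong v (sym (m≥n⇒m⊓n≡n (≮⇒≥ ¬lt)))))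

    -- Here `ν r` is the drop of rank `r` below the top value `X`. The two ranks compared are
    -- `best τ (suc k)` and `displaced τ k` in either case, so the same distance is subtracted for a
    -- worse arrival and added for a better one. The bound by `X` prevents truncation.
    value-correct : ∀ k → k < n → value (v (τ 0)) d τ k ≡ v (τ k)
    value-correct zero    _   = refl
    value-correct (suc k) k<n with best τ k <? τ (suc k)
    ... | yes lt = trans (cong (_∸ d k) (topValue-correct k (<⇒≤ k<n))) (step′ k<n lt)
    ... | no ¬lt = trans (cong (_+ d k) (topValue-correct k (<⇒≤ k<n))) (step k<n (reverse k<n ¬lt))

  -- Vectors as functions on the natural numbers

  -- Total, with default 0 beyond the end, so that sequences of ranks and widths need no bounded
  -- indices.
  nth : Vec ℕ m → ℕ → ℕ
  nth []       _       = 0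
  nth (x ∷ xs) zero    = x
  nth (x ∷ xs) (suc i) = nth xs i

  nth-map< : {A : Set} (f : A → ℕ) {b : ℕ} → (∀ x → f x < b) → 0 < b → (xs : Vec A m) (k : ℕ) →
    nth (Vec.map f xs) k < b
  nth-map< f f<b 0<b []       k       = 0<b
  nth-map< f f<b 0<b (x ∷ xs) zero    = f<b x
  nth-map< f f<b 0<b (x ∷ xs) (suc k) = nth-map< f f<b 0<b xs k

  nth-map : {A : Set} (f : A → ℕ) (xs : Vec A m) (i<m : k < m) →
    nth (Vec.map f xs) k ≡ f (Vec.lookup xs (fromℕ< i<m))
  nth-map {k = zero}  f (x ∷ xs) z<s = refl
  nth-map {k = suc k} f (x ∷ xs) (s<s i<m) = nth-map f xs i<m

  nth-tabulate : (f : Fin m → ℕ) (k<m : k < m) → nth (Vec.tabulate f) k ≡ f (fromℕ< k<m)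
  nth-tabulate {k = zero}  f z<s = refl
  nth-tabulate {k = suc k} f (s<s k<m) = nth-tabulate (f ∘ suc) k<m

  vec-ext : {A : Set} {xs ys : Vec A m} → (∀ i → Vec.lookup xs i ≡ Vec.lookup ys i) → xs ≡ ys
  vec-ext {xs = xs} {ys} eq =
    trans (sym (Vec.tabulate∘lookup xs)) (trans (Vec.tabulate-cong eq) (Vec.tabulate∘lookup ys))

  -- Random sets and the random simulator

  module Construction (b : ℕ) where

    -- Written as `b + 2` so that `suc b` is `B - 1`, the factor in the length of the interval [B ^
    -- e, B ^ (e + 1)).
    B : ℕ
    B = suc (suc b)

    infixl 7 _÷_
    _÷_ : ℕ → ℕ → ℕ
    w ÷ s = (w / B ^ s) {{m^n≢0 B s}}

    -- A strict bound on the values of level `n`. It is a tower, since the values of one level are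
    -- exponents in the next. The top value is below B ^ (range n + 2) and at least B ^ (range n +
    -- 1), which exceeds all widths.
    range : ℕ → ℕ
    range zero    = 1
    range (suc n) = B ^ suc (suc (range n))

    -- A coordinate of exponent e takes c * B ^ e values: c = B for the interval
    -- [0, B ^ (e + 1)), and c = B - 1 for [B ^ e, B ^ (e + 1)), shifted by B ^ e.
    Seed : ℕ → ℕ → Set
    Seed c zero    = ⊤
    Seed c (suc n) = Fin (c * B ^ suc (range n)) × Vec (Fin (c * B ^ range n)) n × Seed c n

    SetSeed SimulatorSeed : ℕ → Set
    SetSeed       = Seed (suc b)
    SimulatorSeed = Seed B

    lifted : ∀ e → Fin (suc b * B ^ e) → ℕ
    lifted e i = B ^ e + toℕ i

    lifted< : ∀ e i → lifted e i < B ^ suc e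
    lifted< e i = +-monoʳ-< (B ^ e) (toℕ<n i)

    widths : Vec (Fin (suc b * B ^ range n)) n → ℕ → ℕ
    widths {n} ws = nth (Vec.map (lifted (range n)) ws)

    -- Rank `suc r` of this level is rank `r` of the level below, whose value sets the scale.
    drop : (ℕ → ℕ) → (ℕ → ℕ) → ℕ → ℕ
    drop w s zero    = 0
    drop w s (suc r) = w r ÷ s r

    rankValue : ∀ n → SetSeed n → ℕ → ℕ
    rankValue zero    _            r = 0
    rankValue (suc n) (x , ws , ω) r = lifted (suc (range n)) x ∸ drop (widths ws) (rankValue n ω) r

    simulate : ∀ n → SimulatorSeed n → (ℕ → ℕ) → ℕ → ℕ
    simulate zero    _            τ k = 0
    simulate (suc n) (x , ws , u) τ k =
      value (toℕ x) (λ j → nth (Vec.map toℕ ws) j ÷ simulate n u (displaced τ) j) τ k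

    -- This makes the simulator online and ordinal: for a fixed seed, the value of a round is
    -- determined by the relative order of the arrivals up to it.
    simulate-cong : ∀ n u {l τ τ′} → OrderIso l τ τ′ → k < l → simulate n u τ k ≡ simulate n u τ′ k
    simulate-cong zero    _            _   _ = refl
    simulate-cong {k} (suc n) (x , ws , u) {suc l} iso k<l =
      value-cong refl iso k k<l λ j j<l →
        cong (nth (Vec.map toℕ ws) j ÷_) (simulate-cong n u (displaced-iso iso) (s<s⁻¹ j<l))

    rankValue< : ∀ n ω r → rankValue n ω r < range n
    rankValue< zero    _            r = z<s
    rankValue< (suc n) (x , ws , ω) r = ≤-<-trans (m∸n≤m _ (drop (widths ws) (rankValue n ω) r)) (lifted< (suc (range n)) x)

    widths≥ : ∀ {n} (ws : Vec (Fin (suc b * B ^ range n)) n) → k < n → B ^ range n ≤ widths ws k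
    widths≥ {n = n} ws k<n rewrite nth-map (lifted (range n)) ws k<n = m≤m+n _ _

    widths< : ∀ {n} (ws : Vec (Fin (suc b * B ^ range n)) n) k → widths ws k < B ^ suc (range n)
    widths< {n} ws = nth-map< (lifted (range n)) (lifted< (range n)) (m^n>0 B (suc (range n))) ws

    ÷-monoˡ : ∀ {w w′} s → w ≤ w′ → w ÷ s ≤ w′ ÷ s
    ÷-monoˡ s = /-monoˡ-≤ (B ^ s) {{m^n≢0 B s}}

    B^÷ : ∀ {e s} → s ≤ e → B ^ e ÷ s ≡ B ^ (e ∸ s)
    B^÷ {e} {s} s≤e = begin
      B ^ e ÷ s                       ≡⟨ cong (λ e → B ^ e ÷ s) (m∸n+n≡m s≤e) ⟨
      B ^ (e ∸ s + s) ÷ s             ≡⟨ cong (_÷ s) (^-distribˡ-+-* B (e ∸ s) s) ⟩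
      (B ^ (e ∸ s) * B ^ s) ÷ s       ≡⟨ m*n/n≡m (B ^ (e ∸ s)) (B ^ s) {{m^n≢0 B s}} ⟩
      B ^ (e ∸ s)                     ∎
      where open ≡-Reasoning

    ÷< : ∀ {w e s} → s ≤ e → w < B ^ e → w ÷ s < B ^ (e ∸ s)
    ÷< {w} {e} {s} s≤e w<B^e = m<n*o⇒m/o<n {w} {B ^ (e ∸ s)} {B ^ s} {{m^n≢0 B s}}
      (subst (w <_) (trans (cong (B ^_) (sym (m∸n+n≡m s≤e))) (^-distribˡ-+-* B (e ∸ s) s)) w<B^e)

    -- With `e = range n`, the drop of rank `suc r` lies in [B ^ (e - s r), B ^ (e + 1 - s r)). As
    -- `s` strictly decreases, these intervals are disjoint and in increasing order.
    drop-mono : ∀ n (ws : Vec (Fin (suc b * B ^ range n)) n) (s : ℕ → ℕ) →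
      (∀ {i j} → i < j → j < n → s j < s i) → (∀ {i} → i < n → s i < range n) →
      ∀ {i j} → i < j → j < suc n → drop (widths ws) s i < drop (widths ws) s j
    drop-mono n ws s s-anti s< {zero} {suc j} _ (s<s j<n) = begin-strict
      0                               <⟨ m^n>0 B (range n ∸ s j) ⟩
      B ^ (range n ∸ s j)             ≡⟨ B^÷ (<⇒≤ (s< j<n)) ⟨
      B ^ range n ÷ s j               ≤⟨ ÷-monoˡ (s j) (widths≥ ws j<n) ⟩
      widths ws j ÷ s j               ∎
      where open ≤-Reasoning
    drop-mono n ws s s-anti s< {suc i} {suc j} (s<s i<j) (s<s j<n) = begin-strict
      widths ws i ÷ s i               <⟨ ÷< (m≤n⇒m≤1+n (<⇒≤ (s< i<n))) (widths< ws i) ⟩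
      B ^ (suc (range n) ∸ s i)       ≤⟨ ^-monoʳ-≤ B (∸-monoʳ-≤ (suc (range n)) (s-anti i<j j<n)) ⟩
      B ^ (range n ∸ s j)             ≡⟨ B^÷ (<⇒≤ (s< j<n)) ⟨
      B ^ range n ÷ s j               ≤⟨ ÷-monoˡ (s j) (widths≥ ws j<n) ⟩
      widths ws j ÷ s j               ∎
      where
      open ≤-Reasoning
      i<n = <-trans i<j j<n

    -- All widths lie below B ^ (range n + 1), which the top value reaches, so the subtraction in
    -- `rankValue` never truncates.
    drop≤lifted : ∀ n x (ws : Vec (Fin (suc b * B ^ range n)) n) s {r} → r < suc n →
      drop (widths ws) s r ≤ lifted (suc (range n)) x
    drop≤lifted n x ws s {zero}  _         = z≤n
    drop≤lifted n x ws s {suc r} (s<s r<n) = begin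
      widths ws r ÷ s r               ≤⟨ m/n≤m _ (B ^ s r) {{m^n≢0 B (s r)}} ⟩
      widths ws r                     ≤⟨ <⇒≤ (widths< ws r) ⟩
      B ^ suc (range n)               ≤⟨ m≤m+n _ _ ⟩
      lifted (suc (range n)) x        ∎
      where open ≤-Reasoning

    rankValue-antitone : ∀ n ω {i j} → i < j → j < n → rankValue n ω j < rankValue n ω i
    rankValue-antitone (suc n) (x , ws , ω) {i} {j} i<j j<n =
      ∸-monoʳ-< (drop-mono n ws (rankValue n ω) (rankValue-antitone n ω) (λ _ → rankValue< n ω _) i<j j<n)
        (drop≤lifted n x ws (rankValue n ω) j<n)

    -- Matching set seeds with simulator seeds

    -- The comparison of round k + 1 is between the ranks best τ (suc k) and
    -- suc (next τ k), whose values differ by the difference of their drops.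
    shifted : ∀ n → SetSeed (suc n) → (ℕ → ℕ) → ℕ → ℕ
    shifted n (x , ws , ω) τ k =
      widths ws (next τ k) ∸
        drop (widths ws) (rankValue n ω) (best τ (suc k)) * B ^ rankValue n ω (next τ k)

    shifted< : ∀ n ω τ k → shifted n ω τ k < B ^ suc (range n)
    shifted< n (x , ws , ω) τ k =
      ≤-<-trans (m∸n≤m _ (drop (widths ws) (rankValue n ω) (best τ (suc k)) * B ^ rankValue n ω (next τ k)))
        (widths< ws (next τ k))

    shiftedSeed : ∀ n → SetSeed (suc n) → (ℕ → ℕ) → Vec (Fin (B * B ^ range n)) n
    shiftedSeed n ω τ = Vec.tabulate (λ k → fromℕ< (shifted< n ω τ (toℕ k)))

    -- The simulator seed that reproduces the values of a given set when the ranks arrive as `τ`.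
    -- Widths are indexed by rank in a set seed and by round in a simulator seed; the first
    -- coordinate is the top value in the former and the value of the first arrival in the latter.
    matching : ∀ n → SetSeed n → (ℕ → ℕ) → SimulatorSeed n
    matching zero    _ τ = tt
    matching (suc n) ω@(_ , _ , ω′) τ =
      -- `range (suc n)` unfolds to `B * B ^ suc (range n)`, the size of the simulator's first
      -- coordinate.
      fromℕ< (rankValue< (suc n) ω (τ 0)) ,
      shiftedSeed n ω τ ,
      matching n ω′ (next τ)

    nth-shifted : ∀ n ω τ {k} → k < n →
      nth (Vec.map toℕ (shiftedSeed n ω τ)) k ≡ shifted n ω τ k
    nth-shifted n ω τ {k} k<n = begin
      nth (Vec.map toℕ (shiftedSeed n ω τ)) k
        ≡⟨ cong (λ (v : Vec ℕ n) → nth v k) (Vec.tabulate-∘ toℕ (λ k → fromℕ< (shifted< n ω τ (toℕ k)))) ⟨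
      nth {n} (Vec.tabulate (λ k → toℕ (fromℕ< (shifted< n ω τ (toℕ k))))) k
        ≡⟨ nth-tabulate (λ k → toℕ (fromℕ< (shifted< n ω τ (toℕ k)))) k<n ⟩
      toℕ (fromℕ< (shifted< n ω τ (toℕ (fromℕ< k<n))))
        ≡⟨ toℕ-fromℕ< (shifted< n ω τ (toℕ (fromℕ< k<n))) ⟩
      shifted n ω τ (toℕ (fromℕ< k<n))
        ≡⟨ cong (shifted n ω τ) (toℕ-fromℕ< k<n) ⟩
      shifted n ω τ k ∎
      where open ≡-Reasoning

    -- By recursion the level below returns the scale of the displaced rank. Subtracting a multiple
    -- of B ^ s before rounding division by B ^ s subtracts its factor afterwards, so each simulated
    -- distance is exactly a difference of two drops.
    simulate-matching : ∀ n ω {τ} → IsRanking n τ → k < n →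
      simulate n (matching n ω τ) τ k ≡ rankValue n ω (τ k)
    simulate-matching {k} (suc n) ω@(x , ws , ω′) {τ} ranking k<n =
      trans (value-cong (toℕ-fromℕ< (rankValue< (suc n) ω (τ 0))) iso-refl k k<n (λ j j<n → distance j (s<s⁻¹ j<n)))
        (value-correct ranking (lifted (suc (range n)) x) (drop (widths ws) s)
          (drop-mono n ws s (rankValue-antitone n ω′) (λ _ → rankValue< n ω′ _))
          (drop≤lifted n x ws s) k k<n)
      where
      s = rankValue n ω′
      distance : ∀ j → j < n →
        nth (Vec.map toℕ (shiftedSeed n ω τ)) j
          ÷ simulate n (matching n ω′ (next τ)) (displaced τ) j
        ≡ drop (widths ws) s (displaced τ j) ∸ drop (widths ws) s (best τ (suc j))
      distance j j<n = begin
        nth (Vec.map toℕ (shiftedSeed n ω τ)) j ÷ simulate n (matching n ω′ (next τ)) (displaced τ) j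
          ≡⟨ cong₂ _÷_ (nth-shifted n ω τ j<n)
               (trans (simulate-cong n (matching n ω′ (next τ)) (displaced-next-iso ranking) j<n)
                      (simulate-matching n ω′ (next-ranking ranking) j<n)) ⟩
        shifted n ω τ j ÷ s c
          ≡⟨ [m∸n*o]/o≡m/o∸n (widths ws c) (drop (widths ws) s (best τ (suc j))) (B ^ s c) {{m^n≢0 B (s c)}} ⟩
        drop (widths ws) s (suc c) ∸ drop (widths ws) s (best τ (suc j))
          ≡⟨ cong (λ r → drop (widths ws) s r ∸ drop (widths ws) s (best τ (suc j))) (suc-next ranking (s<s j<n)) ⟨
        drop (widths ws) s (displaced τ j) ∸ drop (widths ws) s (best τ (suc j)) ∎
        where
        open ≡-Reasoning
        c = next τ j

    -- The displaced rank has the larger drop, so the subtraction in `shifted` does not truncate and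
    -- can be cancelled.
    drop*≤widths : ∀ n (ws : Vec (Fin (suc b * B ^ range n)) n) ω {τ} → IsRanking (suc n) τ → k < n →
      drop (widths ws) (rankValue n ω) (best τ (suc k)) * B ^ rankValue n ω (next τ k) ≤ widths ws (next τ k)
    drop*≤widths {k} n ws ω {τ} ranking k<n = begin
      drop (widths ws) s (best τ (suc k)) * B ^ s c
        ≤⟨ *-monoˡ-≤ (B ^ s c) (<⇒≤ (drop-mono n ws s (rankValue-antitone n ω) (λ _ → rankValue< n ω _)
             (subst (best τ (suc k) <_) (suc-next ranking (s<s k<n)) (best<displaced ranking (s<s k<n)))
             (s<s (IsRanking.bounded (next-ranking ranking) k<n)))) ⟩
      widths ws c ÷ s c * B ^ s c
        ≤⟨ m/n*n≤m (widths ws c) (B ^ s c) {{m^n≢0 B (s c)}} ⟩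
      widths ws c ∎
      where
      open ≤-Reasoning
      s = rankValue n ω
      c = next τ k

    -- Recursion first identifies the lower levels, hence the scales. Every rank arrives, so the
    -- simulation reveals all values: rank 0 gives the top value, then the others give the drops.
    -- These determine the shifts, and undoing the shifts gives the widths.
    matching-injective : ∀ n {ω₁ ω₂ τ} → IsRanking n τ → matching n ω₁ τ ≡ matching n ω₂ τ → ω₁ ≡ ω₂
    matching-injective zero    _ _ = refl
    matching-injective (suc n) {ω₁@(x₁ , ws₁ , ω₁′)} {ω₂@(x₂ , ws₂ , ω₂′)} {τ} ranking eq
      with refl ← matching-injective n (next-ranking ranking) (,-injectiveʳ (,-injectiveʳ eq))
      = same x≡ ws≡
      where
      open IsRanking ranking
      s = rankValue n ω₁′

      values≡ : ∀ {r} → r < suc n → rankValue (suc n) ω₁ r ≡ rankValue (suc n) ω₂ r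
      values≡ r<n with k , k<n , refl ← surjective r<n =
        trans (sym (simulate-matching (suc n) ω₁ ranking k<n))
          (trans (cong (λ u → simulate (suc n) u τ k) eq) (simulate-matching (suc n) ω₂ ranking k<n))

      x≡ : x₁ ≡ x₂
      x≡ = toℕ-injective (+-cancelˡ-≡ (B ^ suc (range n)) (toℕ x₁) (toℕ x₂) (values≡ z<s))

      drop≡ : ∀ {r} → r < suc n → drop (widths ws₁) s r ≡ drop (widths ws₂) s r
      drop≡ {r} r<n = ∸-cancelˡ-≡ (drop≤lifted n x₁ ws₁ s r<n)
        (subst (λ x → drop (widths ws₂) s r ≤ lifted (suc (range n)) x) (sym x≡) (drop≤lifted n x₂ ws₂ s r<n))
        (trans (values≡ r<n) (cong (λ x → lifted (suc (range n)) x ∸ drop (widths ws₂) s r) (sym x≡)))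

      shifted≡ : ∀ {k} → k < n → shifted n ω₁ τ k ≡ shifted n ω₂ τ k
      shifted≡ {k} k<n = trans (sym (nth-shifted n ω₁ τ k<n))
        (trans (cong (λ (v : Vec (Fin (B * B ^ range n)) n) → nth (Vec.map toℕ v) k) (,-injectiveˡ (,-injectiveʳ eq))) (nth-shifted n ω₂ τ k<n))

      widths≡ : ∀ {c} → c < n → widths ws₁ c ≡ widths ws₂ c
      widths≡ c<n with k , k<n , refl ← IsRanking.surjective (next-ranking ranking) c<n =
        ∸-cancelʳ-≡ (drop*≤widths n ws₁ ω₁′ ranking k<n)
          (subst (λ d → d * B ^ s (next τ k) ≤ widths ws₂ (next τ k)) (sym d≡) (drop*≤widths n ws₂ ω₁′ ranking k<n))
          (trans (shifted≡ k<n) (cong (λ d → widths ws₂ (next τ k) ∸ d * B ^ s (next τ k)) (sym d≡)))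
        where
        d≡ : drop (widths ws₁) s (best τ (suc k)) ≡ drop (widths ws₂) s (best τ (suc k))
        d≡ = drop≡ (best-bounded ranking (s<s k<n))

      ws≡ : ws₁ ≡ ws₂
      ws≡ = vec-ext λ i → toℕ-injective (+-cancelˡ-≡ (B ^ range n) _ _ (begin
        lifted (range n) (Vec.lookup ws₁ i)
          ≡⟨ cong (λ i → lifted (range n) (Vec.lookup ws₁ i)) (Fin.fromℕ<-toℕ i (toℕ<n i)) ⟨
        lifted (range n) (Vec.lookup ws₁ (fromℕ< (toℕ<n i)))
          ≡⟨ nth-map (lifted (range n)) ws₁ (toℕ<n i) ⟨
        widths ws₁ (toℕ i)
          ≡⟨ widths≡ (toℕ<n i) ⟩
        widths ws₂ (toℕ i)
          ≡⟨ nth-map (lifted (range n)) ws₂ (toℕ<n i) ⟩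
        lifted (range n) (Vec.lookup ws₂ (fromℕ< (toℕ<n i)))
          ≡⟨ cong (λ i → lifted (range n) (Vec.lookup ws₂ i)) (Fin.fromℕ<-toℕ i (toℕ<n i)) ⟩
        lifted (range n) (Vec.lookup ws₂ i) ∎))
        where open ≡-Reasoning

      same : x₁ ≡ x₂ → ws₁ ≡ ws₂ → ω₁ ≡ ω₂
      same x≡ ws≡ = cong₂ _,_ x≡ (cong (_, ω₁′) ws≡)

    -- Numbers of seeds and their ratio

    size : ℕ → ℕ → ℕ
    size c zero    = 1
    size c (suc n) = c * B ^ suc (range n) * ((c * B ^ range n) ^ n * size c n)

    Vec↔ : ∀ n {k} → Fin (k ^ n) ↔ Vec (Fin k) n
    Vec↔ zero    = ↔-trans 1↔⊤ (mk↔ₛ′ (λ _ → []) (λ _ → tt) (λ { [] → refl }) (λ _ → refl))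
    Vec↔ (suc n) = ↔-trans *↔× (↔-trans (↔-refl ×-↔ Vec↔ n)
      (mk↔ₛ′ (λ (x , xs) → x ∷ xs) Vec.uncons (λ { (x ∷ xs) → refl }) (λ _ → refl)))

    Seed↔ : ∀ c n → Fin (size c n) ↔ Seed c n
    Seed↔ c zero    = 1↔⊤
    Seed↔ c (suc n) = ↔-trans *↔× (↔-refl ×-↔ ↔-trans *↔× (Vec↔ n ×-↔ Seed↔ c n))

  -- Each coordinate of a seed contributes one factor `c` to `size c n`. This exponent does not
  -- involve `B`, so a large `B` brings the ratio of the two sizes close to 1.
  coordinates : ℕ → ℕ
  coordinates zero    = 0
  coordinates (suc n) = suc (n + coordinates n)

  -- Bernoulli's inequality (b / (b + 1)) ^ m ≥ 1 - m / (b + 1), cleared of denominators and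
  -- subtraction.
  bernoulli : ∀ b m → suc b * suc b ^ m ≤ suc b * b ^ m + m * suc b ^ m
  bernoulli b zero    = m≤m+n _ 0
  bernoulli b (suc m) = begin
    suc b * (suc b * suc b ^ m)                              ≤⟨ *-monoʳ-≤ (suc b) (bernoulli b m) ⟩
    suc b * (suc b * b ^ m + m * suc b ^ m)                  ≡⟨ lem₁ b (b ^ m) m (suc b ^ m) ⟩
    suc b * (b * b ^ m) + (suc b * b ^ m + m * (suc b * suc b ^ m))
      ≤⟨ +-monoʳ-≤ (suc b * (b * b ^ m)) (+-monoˡ-≤ (m * (suc b * suc b ^ m))
           (*-monoʳ-≤ (suc b) (^-monoˡ-≤ m (n≤1+n b)))) ⟩
    suc b * (b * b ^ m) + (suc b * suc b ^ m + m * (suc b * suc b ^ m)) ∎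
    where
    open ≤-Reasoning
    open ℕ-Solver
    lem₁ : ∀ b x m y → suc b * (suc b * x + m * y) ≡ suc b * (b * x) + (suc b * x + m * (suc b * y))
    lem₁ = solve 4 (λ b x m y → (con 1 :+ b) :* ((con 1 :+ b) :* x :+ m :* y) :=
      (con 1 :+ b) :* (b :* x) :+ ((con 1 :+ b) :* x :+ m :* ((con 1 :+ b) :* y))) refl

  -- Here m / (b + 1) < 1 / (d + 1), so Bernoulli's inequality gives (b / (b + 1)) ^ m ≥ d / (d +
  -- 1).
  base-large : ∀ d m b → suc b ≡ suc m * suc d → d * suc b ^ m ≤ suc d * b ^ m
  base-large d m b eq = *-cancelˡ-≤ (suc m) (+-cancelʳ-≤ (m * x) _ _ (begin
    suc m * (d * x) + m * x                ≤⟨ +-monoʳ-≤ (suc m * (d * x)) (m≤n+m (m * x) x) ⟩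
    suc m * (d * x) + suc m * x            ≡⟨ lem₁ m d x ⟩
    suc m * suc d * x                      ≡⟨ cong (_* x) eq ⟨
    suc b * x                              ≤⟨ bernoulli b m ⟩
    suc b * y + m * x                      ≡⟨ cong (λ c → c * y + m * x) eq ⟩
    suc m * suc d * y + m * x              ≡⟨ cong (_+ m * x) (*-assoc (suc m) (suc d) y) ⟩
    suc m * (suc d * y) + m * x            ∎))
    where
    open ≤-Reasoning
    open ℕ-Solver
    x = suc b ^ m
    y = b ^ m
    lem₁ : ∀ m d x → suc m * (d * x) + suc m * x ≡ suc m * suc d * x
    lem₁ = solve 3 (λ m d x → (con 1 :+ m) :* (d :* x) :+ (con 1 :+ m) :* x :=
      (con 1 :+ m) :* (con 1 :+ d) :* x) refl

  ^-distribˡ-* : ∀ a b n → (a * b) ^ n ≡ a ^ n * b ^ n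
  ^-distribˡ-* a b zero    = refl
  ^-distribˡ-* a b (suc n) = begin-equality
    a * b * (a * b) ^ n           ≡⟨ cong (a * b *_) (^-distribˡ-* a b n) ⟩
    a * b * (a ^ n * b ^ n)       ≡⟨ [m*n]*[o*p]≡[m*o]*[n*p] a b (a ^ n) (b ^ n) ⟩
    a * a ^ n * (b * b ^ n)       ∎
    where open ≤-Reasoning

  module _ (b : ℕ) where
    open Construction b

    volume : ℕ → ℕ
    volume zero    = 1
    volume (suc n) = B ^ suc (range n) * ((B ^ range n) ^ n * volume n)

    size≡ : ∀ c n → size c n ≡ c ^ coordinates n * volume n
    size≡ c zero    = refl
    size≡ c (suc n) = begin-equality
      c * x * ((c * y) ^ n * size c n)
        ≡⟨ cong₂ (λ p q → c * x * (p * q)) (^-distribˡ-* c y n) (size≡ c n) ⟩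
      c * x * (c ^ n * y ^ n * (c ^ coordinates n * volume n))
        ≡⟨ rearrange c x (c ^ n) (y ^ n) (c ^ coordinates n) (volume n) ⟩
      c * (c ^ n * c ^ coordinates n) * (x * (y ^ n * volume n))
        ≡⟨ cong (λ p → c * p * (x * (y ^ n * volume n))) (^-distribˡ-+-* c n (coordinates n)) ⟨
      c * c ^ (n + coordinates n) * (x * (y ^ n * volume n)) ∎
      where
      open ≤-Reasoning
      open ℕ-Solver
      x = B ^ suc (range n)
      y = B ^ range n
      rearrange : ∀ c x p q r v → c * x * (p * q * (r * v)) ≡ c * (p * r) * (x * (q * v))
      rearrange = solve 6 (λ c x p q r v → c :* x :* (p :* q :* (r :* v)) := c :* (p :* r) :* (x :* (q :* v))) refl

    size-ratio : ∀ d n → B ≡ suc (coordinates n) * suc d → d * size B n ≤ suc d * size (suc b) n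
    size-ratio d n eq = begin
      d * size B n                                   ≡⟨ cong (d *_) (size≡ B n) ⟩
      d * (B ^ coordinates n * volume n)             ≡⟨ *-assoc d (B ^ coordinates n) (volume n) ⟨
      d * B ^ coordinates n * volume n               ≤⟨ *-monoˡ-≤ (volume n) (base-large d (coordinates n) (suc b) eq) ⟩
      suc d * suc b ^ coordinates n * volume n       ≡⟨ *-assoc (suc d) (suc b ^ coordinates n) (volume n) ⟩
      suc d * (suc b ^ coordinates n * volume n)     ≡⟨ cong (suc d *_) (size≡ (suc b) n) ⟨
      suc d * size (suc b) n                         ∎
      where open ≤-Reasoning

    size-nonZero : ∀ c n → NonZero (size (suc c) n)
    size-nonZero c zero    = _
    size-nonZero c (suc n) = m*n≢0 (suc c * B ^ suc (range n)) _
      {{m*n≢0 (suc c) (B ^ suc (range n)) {{_}} {{m^n≢0 B (suc (range n))}}}}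
      {{m*n≢0 ((suc c * B ^ range n) ^ n) (size (suc c) n)
        {{m^n≢0 (suc c * B ^ range n) n {{m*n≢0 (suc c) (B ^ range n) {{_}} {{m^n≢0 B (range n)}}}}}}
        {{size-nonZero c n}}}}

    range-nonZero : ∀ n → NonZero (range n)
    range-nonZero zero    = _
    range-nonZero (suc n) = m^n≢0 B (suc (suc (range n)))

open Combinatorics
open import Defs

-- Order and arithmetic of the reals

Eventually : (ℕ → Set) → Set
Eventually P = ∃ λ M → ∀ i → M ℕ.≤ i → P i

always : {P : ℕ → Set} → (∀ i → P i) → Eventually P
always p = 0 , λ i _ → p i

both : {P Q R : ℕ → Set} → (∀ i → P i → Q i → R i) →
  Eventually P → Eventually Q → Eventually R
both f (M , p) (L , q) = M ℕ.⊔ L , λ i le →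
  f i (p i (ℕ.m⊔n≤o⇒m≤o M L le)) (q i (ℕ.m⊔n≤o⇒n≤o M L le))

mapᵉ : {P Q : ℕ → Set} → (∀ i → P i → Q i) → Eventually P → Eventually Q
mapᵉ f (M , p) = M , λ i le → f i (p i le)

p≤∣p∣ : ∀ p → p ℚ.≤ ℚ.∣ p ∣
p≤∣p∣ p with ℚ.≤-total 0ℚ p
... | inj₁ 0≤p = ℚ.≤-reflexive (sym (ℚ.0≤p⇒∣p∣≡p 0≤p))
... | inj₂ p≤0 = ℚ.≤-trans p≤0 (ℚ.0≤∣p∣ p)

-p≤∣p∣ : ∀ p → ℚ.- p ℚ.≤ ℚ.∣ p ∣
-p≤∣p∣ p = subst (ℚ.- p ℚ.≤_) (ℚ.∣-p∣≡∣p∣ p) (p≤∣p∣ (ℚ.- p))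

∣∣≤ : ∀ p q → p ℚ.≤ q → ℚ.- p ℚ.≤ q → ℚ.∣ p ∣ ℚ.≤ q
∣∣≤ p q p≤q -p≤q with ℚ.∣p∣≡p∨∣p∣≡-p p
... | inj₁ eq = subst (ℚ._≤ q) (sym eq) p≤q
... | inj₂ eq = subst (ℚ._≤ q) (sym eq) -p≤q

≤+⇒-≤ : ∀ x y e → x ℚ.≤ y ℚ.+ e → x ℚ.- y ℚ.≤ e
≤+⇒-≤ x y e h = subst (x ℚ.- y ℚ.≤_) (lem y e) (ℚ.+-monoˡ-≤ (ℚ.- y) h)
  where
  open +-*-Solver
  lem : ∀ y e → (y ℚ.+ e) ℚ.- y ≡ e
  lem = solve 2 (λ y e → (y :+ e) :- y := e) refl

-≤⇒≤+ : ∀ x y e → x ℚ.- y ℚ.≤ e → x ℚ.≤ y ℚ.+ e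
-≤⇒≤+ x y e h = subst (ℚ._≤ y ℚ.+ e) (lem y x) (ℚ.+-monoʳ-≤ y h)
  where
  open +-*-Solver
  lem : ∀ y x → y ℚ.+ (x ℚ.- y) ≡ x
  lem = solve 2 (λ y x → y :+ (x :- y) := x) refl

½-pos : ∀ e → 0ℚ ℚ.< e → 0ℚ ℚ.< e ℚ.* ½
½-pos e 0<e = ℚ.*-monoˡ-<-pos ½ {0ℚ} {e} 0<e

½+½ : ∀ e → e ℚ.* ½ ℚ.+ e ℚ.* ½ ≡ e
½+½ e = trans (sym (ℚ.*-distribˡ-+ e ½ ½)) (ℚ.*-identityʳ e)

½<1 : ∀ e → 0ℚ ℚ.< e → e ℚ.* ½ ℚ.< e
½<1 e 0<e = begin-strict
  e ℚ.* ½              ≡⟨ ℚ.+-identityʳ _ ⟨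
  e ℚ.* ½ ℚ.+ 0ℚ       <⟨ ℚ.+-monoʳ-< (e ℚ.* ½) (½-pos e 0<e) ⟩
  e ℚ.* ½ ℚ.+ e ℚ.* ½  ≡⟨ ½+½ e ⟩
  e                    ∎
  where open ℚ.≤-Reasoning

divide : ∀ K → 0ℚ ℚ.< K → ∀ e → 0ℚ ℚ.< e → ∃ λ d → 0ℚ ℚ.< d × K ℚ.* d ≡ e
divide K 0<K e 0<e = r ℚ.* e , ℚ.positive⁻¹ (r ℚ.* e) {{ℚ.pos*pos⇒pos r e}} ,
  trans (sym (ℚ.*-assoc K r e)) (trans (cong (ℚ._* e) (ℚ.*-inverseʳ K)) (ℚ.*-identityˡ e))
  where
  instance
    K-pos = ℚ.positive 0<K
    K-nonZero = ℚ.pos⇒nonZero K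
    e-pos = ℚ.positive 0<e
  r = ℚ.1/ K
  instance
    r-pos = ℚ.1/pos⇒pos K

Bounded : ℝ → Set
Bounded x = ∃ λ K → 0ℚ ℚ.< K × Eventually (λ i → ℚ.∣ seq x i ∣ ℚ.≤ K)

eventually-bounded : ∀ x → Bounded x
eventually-bounded x with M , close ← cauchy x 1ℚ (ℚ.positive⁻¹ 1ℚ) =
  ℚ.∣ a ∣ ℚ.+ 1ℚ , ℚ.+-mono-≤-< (ℚ.0≤∣p∣ a) (ℚ.positive⁻¹ 1ℚ) , M , λ i M≤i → begin
    ℚ.∣ seq x i ∣                    ≡⟨ cong ℚ.∣_∣ (lem (seq x i) a) ⟩
    ℚ.∣ a ℚ.+ (seq x i ℚ.- a) ∣      ≤⟨ ℚ.∣p+q∣≤∣p∣+∣q∣ a (seq x i ℚ.- a) ⟩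
    ℚ.∣ a ∣ ℚ.+ ℚ.∣ seq x i ℚ.- a ∣  ≤⟨ ℚ.+-monoʳ-≤ ℚ.∣ a ∣ (ℚ.<⇒≤ (close i M M≤i ℕ.≤-refl)) ⟩
    ℚ.∣ a ∣ ℚ.+ 1ℚ                   ∎
  where
  open ℚ.≤-Reasoning
  a = seq x M
  lem : ∀ y a → y ≡ a ℚ.+ (y ℚ.- a)
  lem = solve 2 (λ y a → y := a :+ (y :- a)) refl
    where open +-*-Solver

≃⇒≤ : ∀ {x y} → x ≃ y → x ≤ y
≃⇒≤ {x} {y} (mk≃ close) = mk≤ λ e 0<e →
  mapᵉ (λ i h → -≤⇒≤+ (seq x i) (seq y i) e
    (ℚ.≤-trans (p≤∣p∣ (seq x i ℚ.- seq y i)) (ℚ.<⇒≤ h))) (close e 0<e)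

≤-antisym : ∀ {x y} → x ≤ y → y ≤ x → x ≃ y
≤-antisym {x} {y} (mk≤ x≤y) (mk≤ y≤x) = mk≃ λ e 0<e → both
  (λ i h h′ → ℚ.≤-<-trans
    (∣∣≤ (seq x i ℚ.- seq y i) (e ℚ.* ½) (≤+⇒-≤ (seq x i) (seq y i) (e ℚ.* ½) h)
      (subst (ℚ._≤ e ℚ.* ½) (neg (seq y i) (seq x i))
        (≤+⇒-≤ (seq y i) (seq x i) (e ℚ.* ½) h′)))
    (½<1 e 0<e))
  (x≤y (e ℚ.* ½) (½-pos e 0<e)) (y≤x (e ℚ.* ½) (½-pos e 0<e))
  where
  neg : ∀ y x → y ℚ.- x ≡ ℚ.- (x ℚ.- y)
  neg = solve 2 (λ y x → y :- x := :- (x :- y)) refl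
    where open +-*-Solver

≤-pointwise : ∀ {x y} → Eventually (λ i → seq x i ℚ.≤ seq y i) → x ≤ y
≤-pointwise {x} {y} h = mk≤ λ e 0<e → mapᵉ (λ i x≤y → begin
  seq x i          ≡⟨ ℚ.+-identityʳ (seq x i) ⟨
  seq x i ℚ.+ 0ℚ   ≤⟨ ℚ.+-mono-≤ x≤y (ℚ.<⇒≤ 0<e) ⟩
  seq y i ℚ.+ e    ∎) h
  where open ℚ.≤-Reasoning

≃-pointwise : ∀ {x y} → (∀ i → seq x i ≡ seq y i) → x ≃ y
≃-pointwise x≡y = ≤-antisym
  (≤-pointwise (always λ i → ℚ.≤-reflexive (x≡y i)))
  (≤-pointwise (always λ i → ℚ.≤-reflexive (sym (x≡y i))))

≤-trans : ∀ {x y z} → x ≤ y → y ≤ z → x ≤ z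
≤-trans {x} {y} {z} (mk≤ x≤y) (mk≤ y≤z) = mk≤ λ e 0<e → both
  (λ i h h′ → begin
    seq x i                                ≤⟨ h ⟩
    seq y i ℚ.+ e ℚ.* ½                    ≤⟨ ℚ.+-monoˡ-≤ (e ℚ.* ½) h′ ⟩
    seq z i ℚ.+ e ℚ.* ½ ℚ.+ e ℚ.* ½        ≡⟨ ℚ.+-assoc (seq z i) _ _ ⟩
    seq z i ℚ.+ (e ℚ.* ½ ℚ.+ e ℚ.* ½)      ≡⟨ cong (seq z i ℚ.+_) (½+½ e) ⟩
    seq z i ℚ.+ e                          ∎)
  (x≤y (e ℚ.* ½) (½-pos e 0<e)) (y≤z (e ℚ.* ½) (½-pos e 0<e))
  where open ℚ.≤-Reasoning

≃-refl : ∀ {x} → x ≃ x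
≃-refl = ≃-pointwise λ _ → refl

≤-refl : ∀ {x} → x ≤ x
≤-refl = ≃⇒≤ ≃-refl

≃-sym : ∀ {x y} → x ≃ y → y ≃ x
≃-sym {x} {y} (mk≃ close) = mk≃ λ e 0<e → mapᵉ
  (λ i → subst (ℚ._< e) (trans (sym (ℚ.∣-p∣≡∣p∣ (seq x i ℚ.- seq y i))) (cong ℚ.∣_∣ (neg (seq x i) (seq y i)))))
  (close e 0<e)
  where
  neg : ∀ x y → ℚ.- (x ℚ.- y) ≡ y ℚ.- x
  neg = solve 2 (λ x y → :- (x :- y) := y :- x) refl
    where open +-*-Solver

≃-trans : ∀ {x y z} → x ≃ y → y ≃ z → x ≃ z
≃-trans x≃y y≃z = ≤-antisym (≤-trans (≃⇒≤ x≃y) (≃⇒≤ y≃z))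
  (≤-trans (≃⇒≤ (≃-sym y≃z)) (≃⇒≤ (≃-sym x≃y)))

+-mono-≤ : ∀ {x y u v} → x ≤ y → u ≤ v → x + u ≤ y + v
+-mono-≤ {x} {y} {u} {v} (mk≤ x≤y) (mk≤ u≤v) = mk≤ λ e 0<e → both
  (λ i h h′ → begin
    seq x i ℚ.+ seq u i                                      ≤⟨ ℚ.+-mono-≤ h h′ ⟩
    (seq y i ℚ.+ e ℚ.* ½) ℚ.+ (seq v i ℚ.+ e ℚ.* ½)          ≡⟨ lem (seq y i) (seq v i) (e ℚ.* ½) ⟩
    (seq y i ℚ.+ seq v i) ℚ.+ (e ℚ.* ½ ℚ.+ e ℚ.* ½)          ≡⟨ cong (seq y i ℚ.+ seq v i ℚ.+_) (½+½ e) ⟩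
    (seq y i ℚ.+ seq v i) ℚ.+ e                              ∎)
  (x≤y (e ℚ.* ½) (½-pos e 0<e)) (u≤v (e ℚ.* ½) (½-pos e 0<e))
  where
  open ℚ.≤-Reasoning
  lem : ∀ y v d → (y ℚ.+ d) ℚ.+ (v ℚ.+ d) ≡ (y ℚ.+ v) ℚ.+ (d ℚ.+ d)
  lem = solve 3 (λ y v d → (y :+ d) :+ (v :+ d) := (y :+ v) :+ (d :+ d)) refl
    where open +-*-Solver

+-cong : ∀ {x y u v} → x ≃ y → u ≃ v → x + u ≃ y + v
+-cong x≃y u≃v = ≤-antisym (+-mono-≤ (≃⇒≤ x≃y) (≃⇒≤ u≃v))
  (+-mono-≤ (≃⇒≤ (≃-sym x≃y)) (≃⇒≤ (≃-sym u≃v)))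

*-comm : ∀ x y → x * y ≃ y * x
*-comm x y = ≃-pointwise λ i → ℚ.*-comm (seq x i) (seq y i)

*-congˡ : ∀ w {x y} → x ≃ y → w * x ≃ w * y
*-congˡ w {x} {y} (mk≃ close) = mk≃ λ e 0<e → bounded⇒ (eventually-bounded w) e 0<e
  where
  open +-*-Solver
  factor : ∀ w x y → w ℚ.* x ℚ.- w ℚ.* y ≡ w ℚ.* (x ℚ.- y)
  factor = solve 3 (λ w x y → w :* x :- w :* y := w :* (x :- y)) refl

  bounded⇒ : Bounded w → ∀ e → 0ℚ ℚ.< e →
    Eventually (λ i → ℚ.∣ seq w i ℚ.* seq x i ℚ.- seq w i ℚ.* seq y i ∣ ℚ.< e)
  bounded⇒ (K , 0<K , w≤K) e 0<e with d , 0<d , Kd≡e/2 ← divide K 0<K (e ℚ.* ½) (½-pos e 0<e) = both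
   (λ i hw h → begin-strict
    ℚ.∣ seq w i ℚ.* seq x i ℚ.- seq w i ℚ.* seq y i ∣
      ≡⟨ cong ℚ.∣_∣ (factor (seq w i) (seq x i) (seq y i)) ⟩
    ℚ.∣ seq w i ℚ.* (seq x i ℚ.- seq y i) ∣
      ≡⟨ ℚ.∣p*q∣≡∣p∣*∣q∣ (seq w i) (seq x i ℚ.- seq y i) ⟩
    ℚ.∣ seq w i ∣ ℚ.* ℚ.∣ seq x i ℚ.- seq y i ∣
      ≤⟨ ℚ.*-monoʳ-≤-nonNeg ℚ.∣ seq x i ℚ.- seq y i ∣ {{ℚ.∣-∣-nonNeg (seq x i ℚ.- seq y i)}}
            {ℚ.∣ seq w i ∣} {K} hw ⟩
    K ℚ.* ℚ.∣ seq x i ℚ.- seq y i ∣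
      ≤⟨ ℚ.*-monoˡ-≤-nonNeg K {{ℚ.nonNegative (ℚ.<⇒≤ 0<K)}} {ℚ.∣ seq x i ℚ.- seq y i ∣} {d} (ℚ.<⇒≤ h) ⟩
    K ℚ.* d
      ≡⟨ Kd≡e/2 ⟩
    e ℚ.* ½
      <⟨ ½<1 e 0<e ⟩
    e ∎)
   w≤K (close d 0<d)
   where open ℚ.≤-Reasoning

*-cong : ∀ {x y u v} → x ≃ y → u ≃ v → x * u ≃ y * v
*-cong {x} {y} {u} {v} x≃y u≃v = ≃-trans (*-congˡ x u≃v)
  (≃-trans (*-comm x v) (≃-trans (*-congˡ v x≃y) (*-comm v y)))

-- If w ≥ -d and z ≤ d′ then 0 ≤ (w + d) (d′ - z), so that w z ≤ w d′ + d (d′ - z).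
almost-nonPositive-product : ∀ w z d d′ K L → ℚ.- d ℚ.≤ w → z ℚ.≤ d′ → w ℚ.≤ K → ℚ.- z ℚ.≤ L →
  0ℚ ℚ.≤ d → 0ℚ ℚ.≤ d′ → w ℚ.* z ℚ.≤ K ℚ.* d′ ℚ.+ (d′ ℚ.+ L) ℚ.* d
almost-nonPositive-product w z d d′ K L -d≤w z≤d′ w≤K -z≤L 0≤d 0≤d′ = begin
  w ℚ.* z                                          ≡⟨ ℚ.+-identityʳ (w ℚ.* z) ⟨
  w ℚ.* z ℚ.+ 0ℚ                                   ≤⟨ ℚ.+-monoʳ-≤ (w ℚ.* z) product≥0 ⟩
  w ℚ.* z ℚ.+ (w ℚ.+ d) ℚ.* (d′ ℚ.- z)             ≡⟨ lem w z d d′ ⟩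
  w ℚ.* d′ ℚ.+ (d′ ℚ.+ ℚ.- z) ℚ.* d
    ≤⟨ ℚ.+-mono-≤ (ℚ.*-monoʳ-≤-nonNeg d′ {{ℚ.nonNegative 0≤d′}} {w} {K} w≤K)
                  (ℚ.*-monoʳ-≤-nonNeg d {{ℚ.nonNegative 0≤d}} {d′ ℚ.+ ℚ.- z} {d′ ℚ.+ L} (ℚ.+-monoʳ-≤ d′ -z≤L)) ⟩
  K ℚ.* d′ ℚ.+ (d′ ℚ.+ L) ℚ.* d                    ∎
  where
  open ℚ.≤-Reasoning
  w+d≥0 : 0ℚ ℚ.≤ w ℚ.+ d
  w+d≥0 = subst (ℚ._≤ w ℚ.+ d) (ℚ.+-inverseˡ d) (ℚ.+-monoˡ-≤ d -d≤w)
  d′-z≥0 : 0ℚ ℚ.≤ d′ ℚ.- z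
  d′-z≥0 = subst (ℚ._≤ d′ ℚ.- z) (ℚ.+-inverseʳ z) (ℚ.+-monoˡ-≤ (ℚ.- z) z≤d′)
  product≥0 : 0ℚ ℚ.≤ (w ℚ.+ d) ℚ.* (d′ ℚ.- z)
  product≥0 = ℚ.nonNegative⁻¹ ((w ℚ.+ d) ℚ.* (d′ ℚ.- z)) {{ℚ.nonNeg*nonNeg⇒nonNeg (w ℚ.+ d) {{ℚ.nonNegative w+d≥0}}
    (d′ ℚ.- z) {{ℚ.nonNegative d′-z≥0}}}}
  lem : ∀ w z d d′ → w ℚ.* z ℚ.+ (w ℚ.+ d) ℚ.* (d′ ℚ.- z) ≡ w ℚ.* d′ ℚ.+ (d′ ℚ.+ ℚ.- z) ℚ.* d
  lem = solve 4 (λ w z d d′ → w :* z :+ (w :+ d) :* (d′ :- z) := w :* d′ :+ (d′ :+ :- z) :* d) refl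
    where open +-*-Solver

-- At a given index `w` may be slightly negative and `x` slightly above `y`. With `w` bounded by K
-- and the negative part of x - y by A + C, first the error d′ of x - y is chosen with K d′ = e / 2,
-- then the error d of `w` with (d′ + A + C) d = e / 2.
*-monoˡ-≤ : ∀ w {x y} → 0ℝ ≤ w → x ≤ y → w * x ≤ w * y
*-monoˡ-≤ w {x} {y} (mk≤ 0≤w) (mk≤ x≤y) = mk≤ λ e 0<e →
  bounded⇒ (eventually-bounded w) (eventually-bounded x) (eventually-bounded y) e 0<e
  where
  open ℚ.≤-Reasoning
  open +-*-Solver
  factor : ∀ w x y → w ℚ.* x ℚ.- w ℚ.* y ≡ w ℚ.* (x ℚ.- y)
  factor = solve 3 (λ w x y → w :* x :- w :* y := w :* (x :- y)) refl
  negate : ∀ x y → ℚ.- (x ℚ.- y) ≡ ℚ.- x ℚ.+ y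
  negate = solve 2 (λ x y → :- (x :- y) := :- x :+ y) refl
  cancel : ∀ d w → ℚ.- d ℚ.+ (w ℚ.+ d) ≡ w
  cancel = solve 2 (λ d w → :- d :+ (w :+ d) := w) refl
  -bound : ∀ w d → 0ℚ ℚ.≤ w ℚ.+ d → ℚ.- d ℚ.≤ w
  -bound w d h = begin
    ℚ.- d                   ≡⟨ ℚ.+-identityʳ (ℚ.- d) ⟨
    ℚ.- d ℚ.+ 0ℚ            ≤⟨ ℚ.+-monoʳ-≤ (ℚ.- d) h ⟩
    ℚ.- d ℚ.+ (w ℚ.+ d)     ≡⟨ cancel d w ⟩
    w                       ∎

  bounded⇒ : Bounded w → Bounded x → Bounded y → ∀ e → 0ℚ ℚ.< e →
    Eventually (λ i → seq w i ℚ.* seq x i ℚ.≤ seq w i ℚ.* seq y i ℚ.+ e)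
  bounded⇒ (K , 0<K , w≤K) (A , 0<A , x≤A) (C , 0<C , y≤C) e 0<e =
    choose (divide K 0<K (e ℚ.* ½) (½-pos e 0<e))
    where
    z : ℕ → ℚ
    z i = seq x i ℚ.- seq y i

    -z≤A+C : Eventually (λ i → ℚ.- z i ℚ.≤ A ℚ.+ C)
    -z≤A+C = both (λ i h h′ → begin
      ℚ.- z i                              ≡⟨ negate (seq x i) (seq y i) ⟩
      ℚ.- seq x i ℚ.+ seq y i              ≤⟨ ℚ.+-mono-≤ (-p≤∣p∣ (seq x i)) (p≤∣p∣ (seq y i)) ⟩
      ℚ.∣ seq x i ∣ ℚ.+ ℚ.∣ seq y i ∣      ≤⟨ ℚ.+-mono-≤ h h′ ⟩
      A ℚ.+ C                              ∎) x≤A y≤C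

    conclude : ∀ d′ → 0ℚ ℚ.< d′ → K ℚ.* d′ ≡ e ℚ.* ½ →
      ∃ (λ d → 0ℚ ℚ.< d × (d′ ℚ.+ (A ℚ.+ C)) ℚ.* d ≡ e ℚ.* ½) →
      Eventually (λ i → seq w i ℚ.* seq x i ℚ.≤ seq w i ℚ.* seq y i ℚ.+ e)
    conclude d′ 0<d′ Kd′≡e/2 (d , 0<d , Ld≡e/2) =
      both {P = λ i → ℚ.- d ℚ.≤ seq w i × z i ℚ.≤ d′}
           {Q = λ i → seq w i ℚ.≤ K × ℚ.- z i ℚ.≤ A ℚ.+ C}
        (λ i (w≥ , z≤) (w≤ , z≥) → -≤⇒≤+ (seq w i ℚ.* seq x i) (seq w i ℚ.* seq y i) e (begin
          seq w i ℚ.* seq x i ℚ.- seq w i ℚ.* seq y i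
            ≡⟨ factor (seq w i) (seq x i) (seq y i) ⟩
          seq w i ℚ.* z i
            ≤⟨ almost-nonPositive-product (seq w i) (z i) d d′ K (A ℚ.+ C) w≥ z≤ w≤ z≥
                 (ℚ.<⇒≤ 0<d) (ℚ.<⇒≤ 0<d′) ⟩
          K ℚ.* d′ ℚ.+ (d′ ℚ.+ (A ℚ.+ C)) ℚ.* d
            ≡⟨ cong₂ ℚ._+_ Kd′≡e/2 Ld≡e/2 ⟩
          e ℚ.* ½ ℚ.+ e ℚ.* ½
            ≡⟨ ½+½ e ⟩
          e ∎))
        (both (λ i h h′ → -bound (seq w i) d h , ≤+⇒-≤ (seq x i) (seq y i) d′ h′)
          (0≤w d 0<d) (x≤y d′ 0<d′))
        (both (λ i h h′ → ℚ.≤-trans (p≤∣p∣ (seq w i)) h , h′) w≤K -z≤A+C)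

    choose : ∃ (λ d′ → 0ℚ ℚ.< d′ × K ℚ.* d′ ≡ e ℚ.* ½) →
      Eventually (λ i → seq w i ℚ.* seq x i ℚ.≤ seq w i ℚ.* seq y i ℚ.+ e)
    choose (d′ , 0<d′ , Kd′≡e/2) = conclude d′ 0<d′ Kd′≡e/2
      (divide (d′ ℚ.+ (A ℚ.+ C)) (ℚ.+-mono-< 0<d′ (ℚ.+-mono-< 0<A 0<C)) (e ℚ.* ½) (½-pos e 0<e))

*-monoʳ-≤ : ∀ w {x y} → 0ℝ ≤ w → x ≤ y → x * w ≤ y * w
*-monoʳ-≤ w {x} {y} 0≤w x≤y =
  ≤-trans (≃⇒≤ (*-comm x w)) (≤-trans (*-monoˡ-≤ w 0≤w x≤y) (≃⇒≤ (*-comm w y)))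

-- Finite sums

ℝ-commutativeSemiring : CommutativeSemiring 0ℓ 0ℓ
ℝ-commutativeSemiring = record
  { Carrier = ℝ ; _≈_ = _≃_ ; _+_ = _+_ ; _*_ = _*_ ; 0# = 0ℝ ; 1# = 1ℝ
  ; isCommutativeSemiring = IsCommutativeSemiringˡ.isCommutativeSemiring record
    { +-isCommutativeMonoid = IsCommutativeMonoidˡ.isCommutativeMonoid record
      { isSemigroup = record
        { isMagma = record { isEquivalence = isEquivalence ; ∙-cong = +-cong }
        ; assoc = λ x y z → ≃-pointwise λ i → ℚ.+-assoc (seq x i) (seq y i) (seq z i) }
      ; identityˡ = λ x → ≃-pointwise λ i → ℚ.+-identityˡ (seq x i)
      ; comm = λ x y → ≃-pointwise λ i → ℚ.+-comm (seq x i) (seq y i) }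
    ; *-isCommutativeMonoid = IsCommutativeMonoidˡ.isCommutativeMonoid record
      { isSemigroup = record
        { isMagma = record { isEquivalence = isEquivalence ; ∙-cong = *-cong }
        ; assoc = λ x y z → ≃-pointwise λ i → ℚ.*-assoc (seq x i) (seq y i) (seq z i) }
      ; identityˡ = λ x → ≃-pointwise λ i → ℚ.*-identityˡ (seq x i)
      ; comm = *-comm }
    ; distribʳ = λ x y z → ≃-pointwise λ i → ℚ.*-distribʳ-+ (seq x i) (seq y i) (seq z i)
    ; zeroˡ = λ x → ≃-pointwise λ i → ℚ.*-zeroˡ (seq x i) } }
  where
  open import Relation.Binary.Structures {A = ℝ} _≃_ using (IsEquivalence)
  open import Algebra.Structures.Biased {A = ℝ} _≃_ using
    (module IsCommutativeSemiringˡ; module IsCommutativeMonoidˡ)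
  isEquivalence : IsEquivalence
  isEquivalence = record { refl = ≃-refl ; sym = ≃-sym ; trans = ≃-trans }

open CommutativeSemiring ℝ-commutativeSemiring
  using (semiring; +-identityˡ; +-assoc; *-assoc; *-identityˡ; *-identityʳ; zeroˡ; distribʳ)
open Sum semiring
  using (sum-remove; ∑-comm; sum-cong-≋; *-distribˡ-sum)

∑-mono : {f g : Fin n → ℝ} → (∀ i → f i ≤ g i) → ∑ f ≤ ∑ g
∑-mono {zero}  f≤g = ≤-refl
∑-mono {suc n} f≤g = +-mono-≤ (f≤g zero) (∑-mono (f≤g ∘ suc))

∑-nonNegative : {f : Fin n → ℝ} → (∀ i → 0ℝ ≤ f i) → 0ℝ ≤ ∑ f
∑-nonNegative {zero}  0≤f = ≤-refl
∑-nonNegative {suc n} 0≤f =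
  ≤-trans (≃⇒≤ (≃-sym (+-identityˡ 0ℝ))) (+-mono-≤ (0≤f zero) (∑-nonNegative (0≤f ∘ suc)))

*-nonNegative : ∀ {x y} → 0ℝ ≤ x → 0ℝ ≤ y → 0ℝ ≤ x * y
*-nonNegative {x} {y} 0≤x 0≤y = ≤-trans (≃⇒≤ (≃-sym (zeroˡ y))) (*-monoʳ-≤ y 0≤y 0≤x)

-- Induction splits off the term at `φ zero`. The remaining indices avoid it, so `punchOut` yields
-- an injection into one index fewer; terms never hit are non-negative.
∑-injection : (φ : Fin m → Fin n) → Injective _≡_ _≡_ φ → (f : Fin n → ℝ) →
  (∀ i → 0ℝ ≤ f i) → ∑ (f ∘ φ) ≤ ∑ f
∑-injection {zero}          φ inj f 0≤f = ∑-nonNegative 0≤f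
∑-injection {suc m} {zero}  φ inj f 0≤f with () ← φ zero
∑-injection {suc m} {suc n} φ inj f 0≤f =
  ≤-trans (+-mono-≤ ≤-refl
    (≤-trans (≃⇒≤ (sum-cong-≋ λ j → ≃-pointwise λ i → cong (λ k → seq (f k) i) (sym (punchIn-punchOut (distinct j)))))
      (∑-injection φ′ (λ {j} {k} eq → suc-injective (inj (punchOut-injective (distinct j) (distinct k) eq)))
        (f ∘ punchIn (φ zero)) (0≤f ∘ punchIn (φ zero)))))
    (≃⇒≤ (≃-sym (sum-remove {i = φ zero} f)))
  where
  distinct : ∀ j → φ zero ≡ φ (suc j) → _
  distinct j eq = 0≢1+n (inj eq)
  φ′ : Fin m → Fin n
  φ′ j = punchOut (distinct j)

∑-++ : ∀ m (f : Fin (m ℕ.+ n) → ℝ) → ∑ f ≃ ∑ (λ i → f (i ↑ˡ n)) + ∑ (λ j → f (m ↑ʳ j))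
∑-++ zero    f = ≃-sym (+-identityˡ _)
∑-++ (suc m) f = ≃-trans (+-cong ≃-refl (∑-++ m (f ∘ suc))) (≃-sym (+-assoc _ _ _))

∑-combine : ∀ m n (f : Fin (m ℕ.* n) → ℝ) → ∑ f ≃ ∑ λ i → ∑ λ j → f (combine {m} {n} i j)
∑-combine zero    n f = ≃-refl
∑-combine (suc m) n f = ≃-trans (∑-++ n f) (+-cong ≃-refl (∑-combine m n (λ k → f (n ↑ʳ k))))

-- Expectations and product distributions

𝔼-mono : (D : Distribution A) {f g : A → ℝ} → (∀ x → f x ≤ g x) → 𝔼[ D ] f ≤ 𝔼[ D ] g
𝔼-mono D f≤g = ∑-mono λ i → *-monoˡ-≤ (weight i) (weight≥0 i) (f≤g (outcome i))
  where open Distribution D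

*-swap : ∀ x y z → x * (y * z) ≃ y * (x * z)
*-swap x y z = ≃-trans (≃-sym (*-assoc x y z)) (≃-trans (*-cong (*-comm x y) ≃-refl) (*-assoc y x z))

𝔼-scale : (D : Distribution A) (c : ℝ) (f : A → ℝ) → 𝔼[ D ] (λ x → c * f x) ≃ c * 𝔼[ D ] f
𝔼-scale D c f = ≃-trans (sum-cong-≋ λ i → *-swap (weight i) c (f (outcome i)))
  (≃-sym (*-distribˡ-sum c (λ i → weight i * f (outcome i))))
  where open Distribution D

𝔼-swap : (D : Distribution A) (E : Distribution C) (f : A → C → ℝ) →
  𝔼[ D ] (λ x → 𝔼[ E ] (f x)) ≃ 𝔼[ E ] (λ y → 𝔼[ D ] (λ x → f x y))
𝔼-swap D E f =
  ≃-trans (sum-cong-≋ λ i → *-distribˡ-sum (D.weight i) λ j → E.weight j * f (D.outcome i) (E.outcome j))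
  (≃-trans (∑-comm λ i j → D.weight i * (E.weight j * f (D.outcome i) (E.outcome j)))
  (sum-cong-≋ λ j →
    ≃-trans (sum-cong-≋ λ i → *-swap (D.weight i) (E.weight j) (f (D.outcome i) (E.outcome j)))
      (≃-sym (*-distribˡ-sum (E.weight j) λ i → D.weight i * f (D.outcome i) (E.outcome j)))))
  where
  module D = Distribution D
  module E = Distribution E

mapᴰ : (A → C) → Distribution A → Distribution C
mapᴰ f D = record
  { size = size ; outcome = f ∘ outcome ; weight = weight ; weight≥0 = weight≥0 ; total = total }
  where open Distribution D

infixr 2 _⊗_
_⊗_ : Distribution A → Distribution C → Distribution (A × C)
D ⊗ E = record
  { size = D.size ℕ.* E.size
  ; outcome = λ k → let i , j = remQuot E.size k in D.outcome i , E.outcome j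
  ; weight = λ k → let i , j = remQuot {D.size} E.size k in D.weight i * E.weight j
  ; weight≥0 = λ k → let i , j = remQuot {D.size} E.size k in *-nonNegative (D.weight≥0 i) (E.weight≥0 j)
  ; total = ≃-trans (∑-remQuot λ i j → D.weight i * E.weight j)
      (≃-trans (sum-cong-≋ λ i → ≃-trans (≃-sym (*-distribˡ-sum (D.weight i) E.weight))
        (≃-trans (*-congˡ (D.weight i) E.total) (*-identityʳ (D.weight i)))) D.total)
  }
  where
  module D = Distribution D
  module E = Distribution E
  ∑-remQuot : (f : Fin D.size → Fin E.size → ℝ) →
    ∑ (λ k → uncurry f (remQuot {D.size} E.size k)) ≃ ∑ λ i → ∑ λ j → f i j
  ∑-remQuot f = ≃-trans (∑-combine D.size E.size _) (sum-cong-≋ λ i → sum-cong-≋ λ j →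
    ≃-pointwise λ e → cong (λ p → seq (uncurry f p) e) (remQuot-combine i j))

𝔼-⊗ : (D : Distribution A) (E : Distribution C) (f : A → C → ℝ) →
  𝔼[ D ⊗ E ] (uncurry f) ≃ 𝔼[ D ] (λ x → 𝔼[ E ] (f x))
𝔼-⊗ D E f = ≃-trans (∑-combine D.size E.size _) (sum-cong-≋ λ i →
  ≃-trans (sum-cong-≋ λ j → ≃-trans
    (≃-pointwise λ e → cong (λ (i , j) → seq (D.weight i * E.weight j * f (D.outcome i) (E.outcome j)) e) (remQuot-combine i j))
    (*-assoc (D.weight i) (E.weight j) (f (D.outcome i) (E.outcome j))))
  (≃-sym (*-distribˡ-sum (D.weight i) λ j → E.weight j * f (D.outcome i) (E.outcome j))))
  where
  module D = Distribution D
  module E = Distribution E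

-- Uniform distributions

fromℕ : ℕ → ℚ
fromℕ n = mkℚ (+ n) 0 (ℕ.sym (ℕ.1-coprimeTo n))

fromℕ-suc : ∀ n → fromℕ (suc n) ≡ 1ℚ ℚ.+ fromℕ n
fromℕ-suc n = ℚ.toℚᵘ-injective (ℚᵘ.≃-sym (ℚᵘ.≃-trans (ℚ.toℚᵘ-homo-+ 1ℚ (fromℕ n))
  (ℚᵘ.*≡* (cong (λ k → (+ 1 ℤ.+ k) ℤ.* + 1) (ℤ.*-identityʳ (+ n))))))

fromℕ-* : ∀ m n → fromℕ (m ℕ.* n) ≡ fromℕ m ℚ.* fromℕ n
fromℕ-* m n = ℚ.toℚᵘ-injective (ℚᵘ.≃-sym (ℚᵘ.≃-trans (ℚ.toℚᵘ-homo-* (fromℕ m) (fromℕ n))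
  (ℚᵘ.*≡* (cong (ℤ._* + 1) (sym (ℤ.pos-* m n))))))

fromℕ-mono-≤ : ∀ {m n} → m ℕ.≤ n → fromℕ m ℚ.≤ fromℕ n
fromℕ-mono-≤ m≤n = ℚ.*≤* (ℤ.*-monoʳ-≤-nonNeg (+ 1) (ℤ.+≤+ m≤n))

fromℕ-positive : ∀ n → .{{ℕ.NonZero n}} → ℚ.Positive (fromℕ n)
fromℕ-positive (suc n) = _

-- The denominator of ε is large enough, as the product is then the numerator, a positive integer.
∃-large : ∀ ε → 0ℚ ℚ.< ε → ∃ λ d → 1ℚ ℚ.≤ fromℕ (suc d) ℚ.* ε
∃-large ε@(mkℚ +[1+ a ] d _) _ = d , ℚ.toℚᵘ-cancel-≤ (ℚᵘ.≤-trans
  (ℚᵘ.*≤* (ℤ.+≤+ (begin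
    1 ℕ.* (1 ℕ.* suc d)          ≡⟨ cong (1 ℕ.*_) (ℕ.*-identityˡ (suc d)) ⟩
    1 ℕ.* suc d                  ≡⟨ ℕ.*-identityˡ (suc d) ⟩
    suc d                        ≤⟨ ℕ.m≤m*n (suc d) (suc a) ⟩
    suc d ℕ.* suc a              ≡⟨ ℕ.*-identityʳ _ ⟨
    suc d ℕ.* suc a ℕ.* 1        ∎)))
  (ℚᵘ.≤-reflexive (ℚᵘ.≃-sym (ℚ.toℚᵘ-homo-* (fromℕ (suc d)) ε))))
  where open ℕ.≤-Reasoning
∃-large (mkℚ (+ 0) _ _) (ℚ.*<* (ℤ.+<+ ()))
∃-large (mkℚ ℤ.-[1+ _ ] _ _) (ℚ.*<* ())

1/ : ∀ n → .{{ℕ.NonZero n}} → ℚ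
1/ n = ℚ.1/_ (fromℕ n) {{ℚ.pos⇒nonZero (fromℕ n) {{fromℕ-positive n}}}}

1/-positive : ∀ n .{{_ : ℕ.NonZero n}} → ℚ.Positive (1/ n)
1/-positive n = ℚ.1/pos⇒pos (fromℕ n) {{fromℕ-positive n}}

1/-inverse : ∀ n .{{_ : ℕ.NonZero n}} → fromℕ n ℚ.* 1/ n ≡ 1ℚ
1/-inverse n = ℚ.*-inverseʳ (fromℕ n) {{ℚ.pos⇒nonZero (fromℕ n) {{fromℕ-positive n}}}}

∑-const : ∀ n q i → seq (∑ {n} (λ _ → fromℚ q)) i ≡ fromℕ n ℚ.* q
∑-const zero    q i = sym (ℚ.*-zeroˡ q)
∑-const (suc n) q i = trans (cong (q ℚ.+_) (∑-const n q i))
  (sym (trans (cong (ℚ._* q) (fromℕ-suc n))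
    (trans (ℚ.*-distribʳ-+ q 1ℚ (fromℕ n)) (cong (ℚ._+ fromℕ n ℚ.* q) (ℚ.*-identityˡ q)))))

uniform : ∀ n → .{{ℕ.NonZero n}} → (Fin n → A) → Distribution A
uniform n outcome = record
  { size = n ; outcome = outcome ; weight = λ _ → fromℚ (1/ n)
  ; weight≥0 = λ _ → ≤-pointwise (always λ _ → ℚ.<⇒≤ (ℚ.positive⁻¹ (1/ n) {{1/-positive n}}))
  ; total = ≃-pointwise λ i → trans (∑-const n (1/ n) i) (1/-inverse n) }

-- With D = d + 1, q / p ≤ (D + 1) / D = 1 + 1 / D ≤ 1 + ε.
1/-ratio : ∀ p q d ε .{{_ : ℕ.NonZero p}} .{{_ : ℕ.NonZero q}} → 1ℚ ℚ.≤ fromℕ (suc d) ℚ.* ε →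
  suc d ℕ.* q ℕ.≤ suc (suc d) ℕ.* p → 1/ p ℚ.≤ (1ℚ ℚ.+ ε) ℚ.* 1/ q
1/-ratio p q d ε 1≤Dε Dq≤D′p = begin
  r                                          ≡⟨ insert r s Q (1/-inverse q) ⟩
  Q ℚ.* (s ℚ.* r)
    ≤⟨ ℚ.*-monoʳ-≤-nonNeg (s ℚ.* r) {{ℚ.pos⇒nonNeg (s ℚ.* r) {{ℚ.pos*pos⇒pos s {{1/-positive q}} r {{1/-positive p}}}}}} {Q} {(1ℚ ℚ.+ ε) ℚ.* P} Q≤ ⟩
  (1ℚ ℚ.+ ε) ℚ.* P ℚ.* (s ℚ.* r)             ≡⟨ rearrange (1ℚ ℚ.+ ε) P s r ⟩
  P ℚ.* r ℚ.* ((1ℚ ℚ.+ ε) ℚ.* s)             ≡⟨ cong (ℚ._* ((1ℚ ℚ.+ ε) ℚ.* s)) (1/-inverse p) ⟩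
  1ℚ ℚ.* ((1ℚ ℚ.+ ε) ℚ.* s)                  ≡⟨ ℚ.*-identityˡ ((1ℚ ℚ.+ ε) ℚ.* s) ⟩
  (1ℚ ℚ.+ ε) ℚ.* s                           ∎
  where
  open ℚ.≤-Reasoning
  P = fromℕ p
  Q = fromℕ q
  D = fromℕ (suc d)
  r = 1/ p
  s = 1/ q
  insert : ∀ r s Q → Q ℚ.* s ≡ 1ℚ → r ≡ Q ℚ.* (s ℚ.* r)
  insert r s Q Qs≡1 = sym (trans (sym (ℚ.*-assoc Q s r)) (trans (cong (ℚ._* r) Qs≡1) (ℚ.*-identityˡ r)))
  rearrange : ∀ c P s r → c ℚ.* P ℚ.* (s ℚ.* r) ≡ P ℚ.* r ℚ.* (c ℚ.* s)
  rearrange = solve 4 (λ c P s r → c :* P :* (s :* r) := P :* r :* (c :* s)) refl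
    where open +-*-Solver
  expand : ∀ D ε P → (D ℚ.* ε ℚ.+ D) ℚ.* P ≡ D ℚ.* ((1ℚ ℚ.+ ε) ℚ.* P)
  expand = solve 3 (λ D ε P → (D :* ε :+ D) :* P := D :* ((con 1ℚ :+ ε) :* P)) refl
    where open +-*-Solver
  Q≤ : Q ℚ.≤ (1ℚ ℚ.+ ε) ℚ.* P
  Q≤ = ℚ.*-cancelˡ-≤-pos {Q} {(1ℚ ℚ.+ ε) ℚ.* P} D (begin
    D ℚ.* Q                          ≡⟨ fromℕ-* (suc d) q ⟨
    fromℕ (suc d ℕ.* q)              ≤⟨ fromℕ-mono-≤ Dq≤D′p ⟩
    fromℕ (suc (suc d) ℕ.* p)        ≡⟨ fromℕ-* (suc (suc d)) p ⟩
    fromℕ (suc (suc d)) ℚ.* P        ≡⟨ cong (ℚ._* P) (fromℕ-suc (suc d)) ⟩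
    (1ℚ ℚ.+ D) ℚ.* P
      ≤⟨ ℚ.*-monoʳ-≤-nonNeg P {1ℚ ℚ.+ D} {D ℚ.* ε ℚ.+ D} (ℚ.+-monoˡ-≤ D {1ℚ} {D ℚ.* ε} 1≤Dε) ⟩
    (D ℚ.* ε ℚ.+ D) ℚ.* P            ≡⟨ expand D ε P ⟩
    D ℚ.* ((1ℚ ℚ.+ ε) ℚ.* P)         ∎)

module _ {A : Set ℓ} {C : Set ℓ′} {p q d : ℕ} {ε : ℝ} .{{_ : ℕ.NonZero p}} .{{_ : ℕ.NonZero q}}
  (ε>0 : 0ℝ < ε) (1≤dε : 1ℚ ℚ.≤ fromℕ (suc d) ℚ.* _<_.gap ε>0)
  (dq≤d′p : suc d ℕ.* q ℕ.≤ suc (suc d) ℕ.* p)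
  where

  1/-ratio-ℝ : fromℚ (1/ p) ≤ (1ℝ + ε) * fromℚ (1/ q)
  1/-ratio-ℝ = ≤-pointwise (mapᵉ bound apart)
    where
    open _<_ ε>0
    bound : ∀ i → 0ℚ ℚ.+ gap ℚ.≤ seq ε i → 1/ p ℚ.≤ (1ℚ ℚ.+ seq ε i) ℚ.* 1/ q
    bound i gap≤ε = ℚ.≤-trans (1/-ratio p q d gap 1≤dε dq≤d′p)
      (ℚ.*-monoʳ-≤-nonNeg (1/ q) {{ℚ.pos⇒nonNeg (1/ q) {{1/-positive q}}}} {1ℚ ℚ.+ gap} {1ℚ ℚ.+ seq ε i}
        (ℚ.+-monoʳ-≤ 1ℚ (subst (ℚ._≤ seq ε i) (ℚ.+-identityˡ gap) gap≤ε)))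

  -- Matched outcomes have weights 1 / p and 1 / q, whose ratio is at most 1 + ε; the unmatched
  -- outcomes on the right only add to the expectation of the non-negative `g`.
  𝔼-uniform-injection : (o : Fin p → A) (o′ : Fin q → C) (φ : Fin p → Fin q) → Injective _≡_ _≡_ φ →
    (f : A → ℝ) (g : C → ℝ) → (∀ y → 0ℝ ≤ g y) → (∀ i → f (o i) ≃ g (o′ (φ i))) →
    𝔼[ uniform p o ] f ≤ (1ℝ + ε) * 𝔼[ uniform q o′ ] g
  𝔼-uniform-injection o o′ φ inj f g 0≤g f≃g =
    ≤-trans (≃⇒≤ (≃-sym (*-distribˡ-sum (fromℚ (1/ p)) (f ∘ o))))
    (≤-trans (*-monoˡ-≤ (fromℚ (1/ p)) 0≤1/p (≤-trans (∑-mono (≃⇒≤ ∘ f≃g)) (∑-injection φ inj (g ∘ o′) (0≤g ∘ o′))))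
    (≤-trans (*-monoʳ-≤ (∑ (g ∘ o′)) (∑-nonNegative (0≤g ∘ o′)) 1/-ratio-ℝ)
    (≤-trans (≃⇒≤ (*-assoc (1ℝ + ε) (fromℚ (1/ q)) (∑ (g ∘ o′))))
    (≃⇒≤ (*-congˡ (1ℝ + ε) (*-distribˡ-sum (fromℚ (1/ q)) (g ∘ o′)))))))
    where
    0≤1/p : 0ℝ ≤ fromℚ (1/ p)
    0≤1/p = ≤-pointwise (always λ _ → ℚ.<⇒≤ (ℚ.positive⁻¹ (1/ p) {{1/-positive p}}))

-- Comparison of suprema

sup-mono : ∀ {a b} {I : Set a} {J : Set b} (f : I → ℝ) (g : J → ℝ) (ε : ℝ) → 0ℝ < ε →
  (∀ i → ∃ λ j → f i ≤ (1ℝ + ε) * g j) → sup f ≤̂ (1ℝ + ε) ·̂ sup g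
sup-mono f g ε ε>0 dominated {q} (i , mk< gap 0<gap q<fi) =
  finish (dominated i) (eventually-bounded (1ℝ + ε))
  where
  open ℚ.≤-Reasoning
  finish : (∃ λ j → f i ≤ (1ℝ + ε) * g j) → Bounded (1ℝ + ε) → ((1ℝ + ε) ·̂ sup g) q
  finish (j , mk≤ fi≤) (K , 0<K , c≤K) = conclude (divide K 0<K (gap ℚ.* ½ ℚ.* ½) 0<gap/4)
    where
    gap/4 = gap ℚ.* ½ ℚ.* ½
    0<gap/4 : 0ℚ ℚ.< gap/4
    0<gap/4 = ½-pos (gap ℚ.* ½) (½-pos gap 0<gap)
    conclude : (∃ λ δ → 0ℚ ℚ.< δ × K ℚ.* δ ≡ gap/4) → ((1ℝ + ε) ·̂ sup g) q
    -- The real `r` lies δ below `g j`, where K δ = gap / 4 and K bounds 1 + ε. Of the gap between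
    -- `q` and `f i`, one quarter covers the error in `f i ≤ (1ℝ + ε) * g j`, one quarter covers (1
    -- + ε) δ, and half remains.
    conclude (δ , 0<δ , Kδ≡) = r , (j , r<g) , mk< (gap ℚ.* ½) (½-pos gap 0<gap)
      (both estimate (both (λ i → _,_) q<fi (fi≤ gap/4 0<gap/4)) c≤K)
      where
      r : ℝ
      r = g j + fromℚ (ℚ.- δ)
      r<g : r < g j
      r<g = mk< δ 0<δ (always λ k → ℚ.≤-reflexive (cancel (seq (g j) k) δ))
        where
        cancel : ∀ x δ → x ℚ.+ ℚ.- δ ℚ.+ δ ≡ x
        cancel = solve 2 (λ x δ → x :+ :- δ :+ δ := x) refl
          where open +-*-Solver
      estimate : ∀ k → seq q k ℚ.+ gap ℚ.≤ seq (f i) k ×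
        seq (f i) k ℚ.≤ seq (1ℝ + ε) k ℚ.* seq (g j) k ℚ.+ gap/4 →
        ℚ.∣ seq (1ℝ + ε) k ∣ ℚ.≤ K →
        seq q k ℚ.+ gap ℚ.* ½ ℚ.≤ seq (1ℝ + ε) k ℚ.* (seq (g j) k ℚ.+ ℚ.- δ)
      estimate k (q≤f , f≤cg) c≤K = begin
        x ℚ.+ gap ℚ.* ½                                       ≡⟨ shift x gap ⟩
        (x ℚ.+ gap) ℚ.+ (ℚ.- gap/4 ℚ.+ ℚ.- gap/4)
          ≤⟨ ℚ.+-mono-≤ (ℚ.≤-trans q≤f f≤cg) (ℚ.+-monoʳ-≤ (ℚ.- gap/4) (ℚ.neg-antimono-≤ cδ≤)) ⟩
        (c ℚ.* y ℚ.+ gap/4) ℚ.+ (ℚ.- gap/4 ℚ.+ ℚ.- (c ℚ.* δ)) ≡⟨ collect c y gap/4 δ ⟩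
        c ℚ.* (y ℚ.+ ℚ.- δ)                                   ∎
        where
        x = seq q k
        y = seq (g j) k
        c = seq (1ℝ + ε) k
        cδ≤ : c ℚ.* δ ℚ.≤ gap/4
        cδ≤ = subst (c ℚ.* δ ℚ.≤_) Kδ≡
          (ℚ.*-monoʳ-≤-nonNeg δ {{ℚ.nonNegative (ℚ.<⇒≤ 0<δ)}} {c} {K} (ℚ.≤-trans (p≤∣p∣ c) c≤K))
        shift : ∀ x gap → x ℚ.+ gap ℚ.* ½ ≡
          (x ℚ.+ gap) ℚ.+ (ℚ.- (gap ℚ.* ½ ℚ.* ½) ℚ.+ ℚ.- (gap ℚ.* ½ ℚ.* ½))
        shift = solve 2 (λ x g → x :+ g :* con ½ :=
          (x :+ g) :+ (:- (g :* con ½ :* con ½) :+ :- (g :* con ½ :* con ½))) refl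
          where open +-*-Solver
        collect : ∀ c y h δ → (c ℚ.* y ℚ.+ h) ℚ.+ (ℚ.- h ℚ.+ ℚ.- (c ℚ.* δ)) ≡ c ℚ.* (y ℚ.+ ℚ.- δ)
        collect = solve 4 (λ c y h δ → (c :* y :+ h) :+ (:- h :+ :- (c :* δ)) := c :* (y :+ :- δ)) refl
          where open +-*-Solver

-- Sets with prescribed values

-- The least number belongs to the set exactly when `f zero` is 0; the other elements, lowered by
-- one, form the set for the rest of the range.
increasingSubset : ∀ N n (f : Fin n → ℕ) → (∀ {i j} → i Fin.< j → f i ℕ.< f j) → (∀ i → f i ℕ.< N) →
  Σ (Subset N) λ S → Σ (∣ S ∣ ≡ n) λ eq → ∀ i → toℕ (nthSmallest S i) ≡ f (cast eq i)
increasingSubset zero    zero    f f-mono f< = [] , refl , λ ()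
increasingSubset zero    (suc n) f f-mono f< with () ← f< zero
increasingSubset (suc N) zero    f f-mono f< =
  let S , eq , _ = increasingSubset N zero (λ ()) (λ {}) (λ ()) in
  outside ∷ S , eq , λ i → contradiction (cast eq i) Fin.¬Fin0
increasingSubset (suc N) (suc n) f f-mono f< with f zero in f₀
... | zero =
  let S , eq , nth≡ = increasingSubset N n (pred ∘ f ∘ suc)
        (λ {i} {j} i<j → ℕ.pred-mono-< {{ℕ.>-nonZero (positive i)}} (f-mono (s<s i<j)))
        (λ i → pred< (positive i) (f< (suc i)))
  in inside ∷ S , cong suc eq , λ where
    zero    → sym f₀
    (suc i) → trans (cong suc (nth≡ i)) (ℕ.suc-pred _ {{ℕ.>-nonZero (positive (cast eq i))}})
  where
  positive : ∀ i → 0 ℕ.< f (suc i)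
  positive i = subst (ℕ._< f (suc i)) f₀ (f-mono z<s)
  pred< : ∀ {k l} → 0 ℕ.< k → k ℕ.< suc l → pred k ℕ.< l
  pred< {suc k} _ (s<s k<l) = k<l
... | suc k =
  let S , eq , nth≡ = increasingSubset N (suc n) (pred ∘ f)
        (λ {i} {j} i<j → ℕ.pred-mono-< {{ℕ.>-nonZero (positive i)}} (f-mono i<j))
        (λ i → pred< (positive i) (f< i))
  in outside ∷ S , eq , λ i → trans (cong suc (nth≡ i)) (ℕ.suc-pred _ {{ℕ.>-nonZero (positive (cast eq i))}})
  where
  positive : ∀ i → 0 ℕ.< f i
  positive zero    = subst (0 ℕ.<_) (sym f₀) z<s
  positive (suc i) = ℕ.≤-<-trans z≤n (f-mono {zero} z<s)
  pred< : ∀ {k l} → 0 ℕ.< k → k ℕ.< suc l → pred k ℕ.< l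
  pred< {suc k} _ (s<s k<l) = k<l

opposite-anti : ∀ {i j : Fin n} → i Fin.< j → opposite j Fin.< opposite i
opposite-anti {n} {i} {j} i<j rewrite Fin.opposite-prop i | Fin.opposite-prop j =
  ℕ.∸-monoʳ-< (s<s i<j) (Fin.toℕ<n j)

decreasingSubset : (f : Fin n → ℕ) → (∀ {i j} → i Fin.< j → f j ℕ.< f i) → (∀ i → f i ℕ.< N) →
  Σ (NSubset n N) λ S → ∀ i → toℕ (nthLargest S i) ≡ f i
decreasingSubset {n} {N} f f-anti f<
  with S , refl , nth≡ ← increasingSubset N n (f ∘ opposite) (λ i<j → f-anti (opposite-anti i<j)) (f< ∘ opposite) =
  (S , refl) , λ i → begin
    toℕ (nthSmallest S (opposite (cast refl i)))      ≡⟨ cong (toℕ ∘ nthSmallest S ∘ opposite) (Fin.cast-is-id refl i) ⟩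
    toℕ (nthSmallest S (opposite i))                  ≡⟨ nth≡ (opposite i) ⟩
    f (opposite (cast refl (opposite i)))             ≡⟨ cong (f ∘ opposite) (Fin.cast-is-id refl (opposite i)) ⟩
    f (opposite (opposite i))                         ≡⟨ cong f (Fin.opposite-involutive i) ⟩
    f i                                               ∎
  where open ≡-Reasoning

-- Relative rankings and arrival orders

module _ {a p q : Level} {A : Set a} {P : Pred A p} {Q : Pred A q} (P? : Decidable P) (Q? : Decidable Q) (P⊆Q : P ⊆ Q) where

  count-⊆ : (xs : Vec A m) → Vec.count P? xs ℕ.≤ Vec.count Q? xs
  count-⊆ [] = z≤n
  count-⊆ (x ∷ xs) with P? x | Q? x
  ... | yes _  | yes _  = s≤s (count-⊆ xs)
  ... | no _   | yes _  = ℕ.m≤n⇒m≤1+n (count-⊆ xs)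
  ... | no _   | no _   = count-⊆ xs
  ... | yes px | no ¬qx = contradiction (P⊆Q px) ¬qx

  count-⊂ : (xs : Vec A m) (i : Fin m) → ¬ P (Vec.lookup xs i) → Q (Vec.lookup xs i) →
    Vec.count P? xs ℕ.< Vec.count Q? xs
  count-⊂ (x ∷ xs) zero ¬px qx with P? x | Q? x
  ... | yes px | _      = contradiction px ¬px
  ... | no _   | yes _  = s≤s (count-⊆ xs)
  ... | no _   | no ¬qx = contradiction qx ¬qx
  count-⊂ (x ∷ xs) (suc i) ¬p q with P? x | Q? x
  ... | yes _  | yes _  = s<s (count-⊂ xs i ¬p q)
  ... | no _   | yes _  = ℕ.m≤n⇒m≤1+n (count-⊂ xs i ¬p q)
  ... | no _   | no _   = count-⊂ xs i ¬p q
  ... | yes px | no ¬qx = contradiction (P⊆Q px) ¬qx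

-- A relative rank counts the entries ahead. If r < s, then everything ahead of r is ahead of s, and
-- so is r itself; if s ≤ r, the count for s is at most that for r.
relativeRanking-iso : (xs : Vec (Fin n) m) →
  OrderIso m (nth (relativeRanking xs)) (nth (Vec.map toℕ xs))
relativeRanking-iso {n} xs {i} {j} i<m j<m
  rewrite nth-map (λ r → Vec.count (Fin._<? r) xs) xs i<m
        | nth-map (λ r → Vec.count (Fin._<? r) xs) xs j<m
        | nth-map toℕ xs i<m | nth-map toℕ xs j<m =
  (λ lt → ℕ.≰⇒> λ s≤r → ℕ.<⇒≱ lt (count-⊆ (Fin._<? s) (Fin._<? r) (λ x<s → ℕ.<-≤-trans x<s s≤r) xs)) ,
  (λ r<s → count-⊂ (Fin._<? r) (Fin._<? s) (λ x<r → ℕ.<-trans x<r r<s) xs (fromℕ< i<m) (ℕ.<-irrefl refl) r<s)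
  where
  r = Vec.lookup xs (fromℕ< i<m)
  s = Vec.lookup xs (fromℕ< j<m)

-- Applied to `π ∘ₚ σ`, this lists the overall ranks in order of arrival, continued by 0.
ranks : Permutation′ n → ℕ → ℕ
ranks ρ = nth (Vec.tabulate (toℕ ∘ (ρ ⟨$⟩ʳ_)))

ranks-toℕ : (ρ : Permutation′ n) (i : Fin n) → ranks ρ (toℕ i) ≡ toℕ (ρ ⟨$⟩ʳ i)
ranks-toℕ ρ i = trans (nth-tabulate (toℕ ∘ (ρ ⟨$⟩ʳ_)) (Fin.toℕ<n i))
  (cong (toℕ ∘ (ρ ⟨$⟩ʳ_)) (Fin.fromℕ<-toℕ i (Fin.toℕ<n i)))

ranks-isRanking : (ρ : Permutation′ n) → IsRanking n (ranks ρ)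
ranks-isRanking {n} ρ = record
  { bounded    = λ k<n → subst (ℕ._< n) (sym (nth-tabulate _ k<n)) (Fin.toℕ<n _)
  ; injective  = λ i<n j<n eq → Fin.fromℕ<-injective _ _ i<n j<n
      (ρ-injective (Fin.toℕ-injective (trans (sym (nth-tabulate _ i<n)) (trans eq (nth-tabulate _ j<n)))))
  ; surjective = λ r<n → toℕ (ρ ⟨$⟩ˡ fromℕ< r<n) , Fin.toℕ<n _ ,
      trans (ranks-toℕ ρ (ρ ⟨$⟩ˡ fromℕ< r<n)) (trans (cong toℕ (inverseʳ ρ)) (Fin.toℕ-fromℕ< r<n)) }
  where
  ρ-injective : ∀ {i j} → ρ ⟨$⟩ʳ i ≡ ρ ⟨$⟩ʳ j → i ≡ j
  ρ-injective eq = trans (sym (inverseˡ ρ)) (trans (cong (ρ ⟨$⟩ˡ_) eq) (inverseˡ ρ))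

relativeRanking-ranks : (σ π : Sym n) (k : Fin n) →
  OrderIso (suc (toℕ k)) (nth (relativeRanking (Vec.map (σ ⟨$⟩ʳ_) (arrived π k)))) (ranks (π ∘ₚ σ))
relativeRanking-ranks σ π k =
  iso-respʳ {τ = nth (relativeRanking xs)} (relativeRanking-iso xs) agree
  where
  xs = Vec.map (σ ⟨$⟩ʳ_) (arrived π k)
  agree : ∀ {i} → i ℕ.< suc (toℕ k) →
    nth (Vec.map toℕ (Vec.map (σ ⟨$⟩ʳ_) (arrived π k))) i ≡ ranks (π ∘ₚ σ) i
  agree {i} i<k = begin
    nth (Vec.map toℕ (Vec.map (σ ⟨$⟩ʳ_) (arrived π k))) i
      ≡⟨ nth-map toℕ (Vec.map (σ ⟨$⟩ʳ_) (arrived π k)) i<k ⟩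
    toℕ (Vec.lookup (Vec.map (σ ⟨$⟩ʳ_) (arrived π k)) i′)
      ≡⟨ cong toℕ (Vec.lookup-map i′ (σ ⟨$⟩ʳ_) (arrived π k)) ⟩
    toℕ (σ ⟨$⟩ʳ Vec.lookup (arrived π k) i′)
      ≡⟨ cong (toℕ ∘ (σ ⟨$⟩ʳ_)) (Vec.lookup∘tabulate (λ j → π ⟨$⟩ʳ inject≤ j (Fin.toℕ<n k)) i′) ⟩
    toℕ (π ∘ₚ σ ⟨$⟩ʳ inject≤ i′ (Fin.toℕ<n k))
      ≡⟨ ranks-toℕ (π ∘ₚ σ) (inject≤ i′ (Fin.toℕ<n k)) ⟨
    ranks (π ∘ₚ σ) (toℕ (inject≤ i′ (Fin.toℕ<n k)))
      ≡⟨ cong (ranks (π ∘ₚ σ)) (trans (Fin.toℕ-inject≤ i′ (Fin.toℕ<n k)) (Fin.toℕ-fromℕ< i<k)) ⟩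
    ranks (π ∘ₚ σ) i ∎
    where
    open ≡-Reasoning
    i′ = fromℕ< i<k

-- Running a cardinal algorithm on simulated values

module Simulation (T : OnlineTask ℓ n) (b : ℕ) where
  open OnlineTask T
  open Construction b

  private instance
    range≢0 : NonZero (range n)
    range≢0 = range-nonZero b n
    size-Set≢0 : NonZero (size (suc b) n)
    size-Set≢0 = size-nonZero b b n
    size-Simulator≢0 : NonZero (size B n)
    size-Simulator≢0 = size-nonZero b (suc b) n

  setOf : (ω : SetSeed n) → Σ (NSubset n (range n)) λ S → ∀ i → toℕ (nthLargest S i) ≡ rankValue n ω (toℕ i)
  setOf ω = decreasingSubset (rankValue n ω ∘ toℕ) (λ {i} {j} i<j → rankValue-antitone n ω i<j (Fin.toℕ<n j))
    (rankValue< n ω ∘ toℕ)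

  -- Each round reruns the simulation on all relative ranks seen so far; by `simulate-cong` earlier
  -- values do not change. An unmatched seed may produce values outside the range, which `mod`
  -- brings back; on matched seeds `mod` changes nothing.
  simulated : DetCard T (range n) → SimulatorSeed n → DetOrd T
  simulated alg u k els rr = alg k els (Vec.tabulate λ j → simulate n u (nth rr) (toℕ j) mod range n)

  simulated-matching : ∀ alg ω (σ π : Sym n) k →
    runCard T alg (values (proj₁ (setOf ω)) σ) π k ≡
    runOrd T (simulated alg (matching n ω (ranks (π ∘ₚ σ)))) σ π k
  simulated-matching alg ω σ π k = cong (alg k (arrived π k)) (begin
    Vec.map (values S σ) (arrived π k)
      ≡⟨ Vec.tabulate-∘ (values S σ) (λ j → π ⟨$⟩ʳ inject≤ j (Fin.toℕ<n k)) ⟨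
    Vec.tabulate (λ j → values S σ (π ⟨$⟩ʳ inject≤ j (Fin.toℕ<n k)))
      ≡⟨ Vec.tabulate-cong (λ j → Fin.toℕ-injective (agree j)) ⟩
    Vec.tabulate (λ j → simulate n u (nth rr) (toℕ j) mod range n) ∎)
    where
    open ≡-Reasoning
    S = proj₁ (setOf ω)
    τ = ranks (π ∘ₚ σ)
    u = matching n ω τ
    rr = relativeRanking (Vec.map (σ ⟨$⟩ʳ_) (arrived π k))
    value≡ : ∀ j → simulate n u (nth rr) (toℕ j) ≡ rankValue n ω (toℕ (π ∘ₚ σ ⟨$⟩ʳ inject≤ j (Fin.toℕ<n k)))
    value≡ j = begin
      simulate n u (nth rr) (toℕ j)
        ≡⟨ simulate-cong n u (relativeRanking-ranks σ π k) (Fin.toℕ<n j) ⟩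
      simulate n u τ (toℕ j)
        ≡⟨ simulate-matching n ω (ranks-isRanking (π ∘ₚ σ)) (ℕ.<-≤-trans (Fin.toℕ<n j) (Fin.toℕ<n k)) ⟩
      rankValue n ω (τ (toℕ j))
        ≡⟨ cong (rankValue n ω ∘ τ) (Fin.toℕ-inject≤ j (Fin.toℕ<n k)) ⟨
      rankValue n ω (τ (toℕ (inject≤ j (Fin.toℕ<n k))))
        ≡⟨ cong (rankValue n ω) (ranks-toℕ (π ∘ₚ σ) (inject≤ j (Fin.toℕ<n k))) ⟩
      rankValue n ω (toℕ (π ∘ₚ σ ⟨$⟩ʳ inject≤ j (Fin.toℕ<n k))) ∎
    agree : ∀ j → toℕ (values S σ (π ⟨$⟩ʳ inject≤ j (Fin.toℕ<n k))) ≡ toℕ (simulate n u (nth rr) (toℕ j) mod range n)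
    agree j = sym (begin
      toℕ (simulate n u (nth rr) (toℕ j) mod range n)
        ≡⟨ cong (λ v → toℕ (v mod range n)) (value≡ j) ⟩
      toℕ (rankValue n ω r mod range n)
        ≡⟨ Fin.toℕ-fromℕ< _ ⟩
      rankValue n ω r % range n
        ≡⟨ m<n⇒m%n≡m (rankValue< n ω r) ⟩
      rankValue n ω r
        ≡⟨ proj₂ (setOf ω) (π ∘ₚ σ ⟨$⟩ʳ inject≤ j (Fin.toℕ<n k)) ⟨
      toℕ (values S σ (π ⟨$⟩ʳ inject≤ j (Fin.toℕ<n k))) ∎)
      where r = toℕ (π ∘ₚ σ ⟨$⟩ʳ inject≤ j (Fin.toℕ<n k))

  setSeed : Fin (size (suc b) n) → SetSeed n
  setSeed = Inverse.to (Seed↔ (suc b) n)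

  simulatorSeed : Fin (size B n) → SimulatorSeed n
  simulatorSeed = Inverse.to (Seed↔ B n)

  hardSets : Distribution (NSubset n (range n))
  hardSets = uniform (size (suc b) n) (proj₁ ∘ setOf ∘ setSeed)

  simulatorSeeds : Distribution (SimulatorSeed n)
  simulatorSeeds = uniform (size B n) simulatorSeed

  matchingIndex : (ℕ → ℕ) → Fin (size (suc b) n) → Fin (size B n)
  matchingIndex τ i = Inverse.from (Seed↔ B n) (matching n (setSeed i) τ)

  simulatorSeed-matchingIndex : ∀ τ i → simulatorSeed (matchingIndex τ i) ≡ matching n (setSeed i) τ
  simulatorSeed-matchingIndex τ i = Inverse.strictlyInverseˡ (Seed↔ B n) _

  matchingIndex-injective : ∀ {τ} → IsRanking n τ → ∀ {i j} → matchingIndex τ i ≡ matchingIndex τ j → i ≡ j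
  matchingIndex-injective {τ} ranking {i} {j} eq = to-injective (Seed↔ (suc b) n)
    (matching-injective n ranking (to-injective (↔-sym (Seed↔ B n)) eq))
    where
    to-injective : ∀ {A B : Set} (A↔B : A ↔ B) {x y} → Inverse.to A↔B x ≡ Inverse.to A↔B y → x ≡ y
    to-injective A↔B {x} {y} eq = trans (sym (Inverse.strictlyInverseʳ A↔B x))
      (trans (cong (Inverse.from A↔B) eq) (Inverse.strictlyInverseʳ A↔B y))

  simulatedMixture : Card T (range n) → Ord T
  simulatedMixture ALG = mapᴰ (uncurry simulated) (ALG ⊗ simulatorSeeds)

  module _ (d : ℕ) (B-large : B ≡ suc (coordinates n) ℕ.* suc (suc d))
    (ε : ℝ) (ε>0 : 0ℝ < ε) (dε≥1 : ℚ.1ℚ ℚ.≤ fromℕ (suc d) ℚ.* _<_.gap ε>0)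
    (Dπ Dσ : Distribution (Sym n)) (ALG : Card T (range n))
    where

    cardValue : DetCard T (range n) → (σ π : Sym n) → NSubset n (range n) → ℝ
    cardValue alg σ π S = R (runCard T alg (values S σ) π) σ π

    simulatedValue : (σ π : Sym n) → DetCard T (range n) → SimulatorSeed n → ℝ
    simulatedValue σ π alg u = R (runOrd T (simulated alg u) σ π) σ π

    -- The injection of seeds depends on the arrival order of the ranks, but the two laws do not.
    -- Hence the bound holds for each `σ` and `π` separately and survives averaging.
    cardValue≤ : ∀ alg σ π →
      𝔼[ hardSets ] (cardValue alg σ π) ≤ (1ℝ + ε) * 𝔼[ simulatorSeeds ] (simulatedValue σ π alg)
    cardValue≤ alg σ π = 𝔼-uniform-injection ε>0 dε≥1 (size-ratio b (suc d) n B-large)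
      (proj₁ ∘ setOf ∘ setSeed) simulatorSeed (matchingIndex τ) (matchingIndex-injective (ranks-isRanking (π ∘ₚ σ)))
      (cardValue alg σ π) (simulatedValue σ π alg) (λ u → R≥0 (runOrd T (simulated alg u) σ π) σ π)
      (λ i → R-cong {σ = σ} {σ} {π} {π} (λ k → trans (simulated-matching alg (setSeed i) σ π k)
        (cong (λ u → runOrd T (simulated alg u) σ π k) (sym (simulatorSeed-matchingIndex τ i))))
        (λ _ → refl) (λ _ → refl))
      where τ = ranks (π ∘ₚ σ)

    -- Finite expectations are interchanged until the one over sets is innermost, where the bound
    -- for fixed `alg`, `σ` and `π` applies. The simulator's seed then joins the mixture of
    -- algorithms.
    cardReward≤ : cardReward T Dπ hardSets Dσ ALG ≤ (1ℝ + ε) * ordReward T Dπ Dσ (simulatedMixture ALG)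
    cardReward≤ = ≤-trans (𝔼-mono Dπ π-part) (≃⇒≤ (𝔼-scale Dπ (1ℝ + ε)
        (λ π → 𝔼[ Dσ ] λ σ → 𝔼[ ALG ⊗ simulatorSeeds ] (uncurry (simulatedValue σ π)))))
      where
      σ-part : ∀ π σ → 𝔼[ hardSets ] (λ S → 𝔼[ ALG ] λ alg → cardValue alg σ π S) ≤
        (1ℝ + ε) * 𝔼[ ALG ⊗ simulatorSeeds ] (uncurry (simulatedValue σ π))
      σ-part π σ =
        ≤-trans (≃⇒≤ (𝔼-swap hardSets ALG λ S alg → cardValue alg σ π S))
        (≤-trans (𝔼-mono ALG λ alg → cardValue≤ alg σ π)
        (≤-trans (≃⇒≤ (𝔼-scale ALG (1ℝ + ε) λ alg → 𝔼[ simulatorSeeds ] (simulatedValue σ π alg)))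
        (≃⇒≤ (*-congˡ (1ℝ + ε) (≃-sym (𝔼-⊗ ALG simulatorSeeds (simulatedValue σ π)))))))
      π-part : ∀ π → 𝔼[ hardSets ] (λ S → 𝔼[ Dσ ] λ σ → 𝔼[ ALG ] λ alg → cardValue alg σ π S) ≤
        (1ℝ + ε) * 𝔼[ Dσ ] (λ σ → 𝔼[ ALG ⊗ simulatorSeeds ] (uncurry (simulatedValue σ π)))
      π-part π =
        ≤-trans (≃⇒≤ (𝔼-swap hardSets Dσ λ S σ → 𝔼[ ALG ] λ alg → cardValue alg σ π S))
        (≤-trans (𝔼-mono Dσ (σ-part π))
        (≃⇒≤ (𝔼-scale Dσ (1ℝ + ε) λ σ → 𝔼[ ALG ⊗ simulatorSeeds ] (uncurry (simulatedValue σ π)))))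

theorem1p1 : {ℓ : Level} (n : ℕ) (T : OnlineTask ℓ n)
    (Dπ : Distribution (Sym n)) (Dσ : Distribution (Sym n))
    (ε : ℝ) → 0ℝ < ε →
    Σ ℕ λ N → Σ (Distribution (NSubset n N)) λ F →
    sup (cardReward T Dπ F Dσ) ≤̂ (1ℝ + ε) ·̂ sup (ordReward T Dπ Dσ)
theorem1p1 n T Dπ Dσ ε ε>0 with d , dε≥1 ← ∃-large (_<_.gap ε>0) (_<_.gap>0 ε>0) =
  Construction.range b n , hardSets ,
  sup-mono (cardReward T Dπ hardSets Dσ) (ordReward T Dπ Dσ) ε ε>0 λ ALG →
    simulatedMixture ALG , cardReward≤ d refl ε ε>0 dε≥1 Dπ Dσ ALG
  where
  -- This makes `B` equal to (coordinates n + 1) (d + 2), so the ratio of the seed counts is at most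
  -- (d + 2) / (d + 1), and 1 / (d + 1) is at most the rational gap below ε.
  b = d ℕ.+ coordinates n ℕ.* suc (suc d)
  open Simulation T b
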